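{- Let $n,c$ be positive integers. A plane partition $\pi=(\pi_{i,j})_{1\le i,j\le n}$ inside an $(n,n,c)$-box is called quasi transpose-complementary if $\pi_{i,j}+\pi_{n+1-j,n+1-i}=c$ for all $1\le i,j\le n$ with $i\ne n+1-j$. Then the number of quasi transpose-complementary plane partitions inside an $(n,n,c)$-box equals the number of symmetric plane partitions inside an $(n,n,c)$-box.
   Context: A plane partition inside an $(a,b,c)$-box is an array $(\pi_{i,j})_{1\le i\le a,1\le j\le b}$ of integers with $0\le\pi_{i,j}\le c$, weakly decreasing along rows and columns ($\pi_{i,j}\ge\pi_{i+1,j}$, $\pi_{i,j}\ge\pi_{i,j+1}$). It is symmetric (for $a=b$) if $\pi_{i,j}=\pi_{j,i}$ for all $i,j$. -}

module Defs where

open import Data.Nat using (ℕ; zero; suc; _+_; _≥_; _≤_; _≤?_)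
open import Data.Fin using (Fin; toℕ; opposite)
open import Data.Fin.Properties using (all?) renaming (_≟_ to _≟ᶠ_)
open import Data.Vec using (Vec; []; _∷_; lookup)
open import Data.List using (List; []; _∷_; upTo; concatMap; map; filter; length)
import Data.Nat.Properties as ℕP
open import Relation.Binary.PropositionalEquality using (_≡_; _≢_)
open import Relation.Unary using (Pred; Decidable)
open import Relation.Nullary using (Dec; ¬_)
open import Relation.Nullary.Decidable using (_×-dec_; _→-dec_; ¬?)
open import Data.Product using (_×_)
open import Level using (0ℓ)

Array : ℕ → Set
Array n = Vec (Vec ℕ n) n

-- entry π_{i,j} (indices 0-based: i,j ∈ {0,…,n-1} correspond to 1,…,n)
entry : ∀ {n} → Array n → Fin n → Fin n → ℕ
entry π i j = lookup (lookup π i) j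

allVecs : (c m : ℕ) → List (Vec ℕ m)
allVecs c zero = [] ∷ []
allVecs c (suc m) = concatMap (λ x → map (x ∷_) (allVecs c m)) (upTo (suc c))

allArrays : (n c : ℕ) → List (Array n)
allArrays n c = allVecsOf (allVecs c n) n
  where
  allVecsOf : ∀ {A : Set} → List A → (m : ℕ) → List (Vec A m)
  allVecsOf xs zero = [] ∷ []
  allVecsOf xs (suc m) = concatMap (λ x → map (x ∷_) (allVecsOf xs m)) xs

IsPlanePartition : (n c : ℕ) → Array n → Set
IsPlanePartition n c π =
  (∀ i j → entry π i j ≤ c) ×
  (∀ (i i' j : Fin n) → toℕ i ≤ toℕ i' → entry π i' j ≤ entry π i j) ×
  (∀ (i j j' : Fin n) → toℕ j ≤ toℕ j' → entry π i j' ≤ entry π i j)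

IsSymmetric : ∀ {n} → Array n → Set
IsSymmetric π = ∀ i j → entry π i j ≡ entry π j i

-- Quasi transpose-complementary: π_{i,j} + π_{n+1-j,n+1-i} = c whenever i ≠ n+1-j.
-- With 0-based indices, n+1-j corresponds to `opposite j` (= n-1-j).
IsQuasiTC : (n c : ℕ) → Array n → Set
IsQuasiTC n c π =
  ∀ (i j : Fin n) → i ≢ opposite j → entry π i j + entry π (opposite j) (opposite i) ≡ c

isPP? : ∀ n c → Decidable (IsPlanePartition n c)
isPP? n c π =
  all? (λ i → all? (λ j → entry π i j ≤? c)) ×-dec
  (all? (λ i → all? (λ i' → all? (λ j → (toℕ i ≤? toℕ i') →-dec (entry π i' j ≤? entry π i j)))) ×-dec
   all? (λ i → all? (λ j → all? (λ j' → (toℕ j ≤? toℕ j') →-dec (entry π i j' ≤? entry π i j)))))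

isSym? : ∀ {n} → Decidable (IsSymmetric {n})
isSym? π = all? (λ i → all? (λ j → entry π i j ℕP.≟ entry π j i))

isQTC? : ∀ n c → Decidable (IsQuasiTC n c)
isQTC? n c π = all? (λ i → all? (λ j →
  ¬? (i ≟ᶠ opposite j) →-dec (entry π i j + entry π (opposite j) (opposite i) ℕP.≟ c)))

numSymmetricPP : ℕ → ℕ → ℕ
numSymmetricPP n c = length (filter (λ π → isPP? n c π ×-dec isSym? π) (allArrays n c))

numQuasiTCPP : ℕ → ℕ → ℕ
numQuasiTCPP n c = length (filter (λ π → isPP? n c π ×-dec isQTC? n c π) (allArrays n c))

{-# OPTIONS --safe #-}

-- Reading the columns backwards turns a quasi transpose-complementary plane partition into a
-- matrix e with e i j + e j i = c off the diagonal. Its lower triangle records last-passage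
-- values of a triangle w of natural numbers, and the condition on the diagonal says that paths
-- across the symmetric matrix with upper half w, from its top right to its bottom left corner,
-- have weight at most c.
-- A column-by-column sweep in the spirit of the Burge correspondence strips a 0-1 vector from w
-- and lowers the maximal path weight, unless it is 0, by exactly one. A vector and a triangle
-- arise from such a step iff the vector dominates the one stripped next, so w amounts to a chain
-- of c vectors, each dominating the next; these are the boundaries of the level sets of a
-- symmetric plane partition.

module Submission where

open import Defs
open import Data.Bool using (Bool; true; false)
open import Data.Fin as Fin using (Fin; toℕ; fromℕ<; opposite)
open import Data.Fin.Properties
  using (injective⇒≤; toℕ-fromℕ<; toℕ<n; toℕ-injective; opposite-prop; opposite-involutive)
open import Data.List as List using (List; []; _∷_; concatMap; map; filter; length; cartesianProductWith; upTo)
open import Data.List.Membership.Propositional using (_∈_)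
open import Data.List.Membership.Propositional.Properties
  using (∈-lookup; ∈-filter⁺; ∈-filter⁻; ∈-upTo⁺; ∈-cartesianProductWith⁺)
import Data.List.Relation.Unary.All as All
open import Data.List.Relation.Unary.AllPairs using ([]; _∷_)
open import Data.List.Relation.Unary.Any as Any using (here; there)
open import Data.List.Relation.Unary.Any.Properties using (lookup-index)
open import Data.List.Relation.Unary.Unique.Propositional using (Unique)
import Data.List.Relation.Unary.Unique.Propositional.Properties as Unique
open import Data.Nat
open import Data.Nat.Properties
open import Data.Nat.Tactic.RingSolver using (solve-∀)
open import Data.Product using (_×_; _,_; ∃; ∃₂; proj₁; proj₂)
open import Data.Sum using (_⊎_; inj₁; inj₂)
open import Data.Unit using (⊤; tt)
open import Data.Vec as Vec using (Vec; []; _∷_; lookup; replicate; tabulate)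
open import Data.Vec.Properties using (∷-injective; lookup∘tabulate; tabulate∘lookup; tabulate-cong)
open import Data.Vec.Relation.Unary.All as VAll using ([]; _∷_)
open import Function using (_∘_)
open import Function.Bundles using (_⇔_; mk⇔; module Equivalence)
open import Level using (0ℓ)
open import Relation.Binary using (tri<; tri≈; tri>)
open import Relation.Binary.PropositionalEquality
open import Relation.Nullary using (yes; no; contradiction)
open import Relation.Nullary.Decidable using (_×-dec_)
open import Relation.Unary using (Pred; Decidable)

open Equivalence using (to; from)

-- Comparing the enumerations

-- The rule at a single entry of a column loses no information: the two outgoing bits and the new
-- entry determine the old ones. So a strip can be undone, except that the bit then found at the top
-- of a column must be 0. Dominance over the vector stripped next is exactly this condition, because
-- it compares what two consecutive sweeps carry down the same column. The obstacle is the path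
-- weight. That the maximal weight drops by one does not survive adding a column, since the heights
-- further down may move either way. The induction needs `Shifted`, which pins the change where a 1
-- is stripped and keeps the other heights from mattering in maxima. On the symmetric side, a 0-1
-- vector of length n traces the boundary of a level set across the diagonals of one half: its
-- prefix sums count the cells of the set on each diagonal, so dominance is containment. The
-- correspondence is kept as a relation that is total and injective in both directions, and each
-- direction gives one inequality between the counts.

module _ {A : Set} where

  lookup-injective : ∀ {xs : List A} → Unique xs → ∀ i j → List.lookup xs i ≡ List.lookup xs j → i ≡ j
  lookup-injective (_ ∷ _)  Fin.zero    Fin.zero    _  = refl
  lookup-injective (p ∷ _)  Fin.zero    (Fin.suc j) eq = contradiction eq (All.lookup p (∈-lookup j))
  lookup-injective (p ∷ _)  (Fin.suc i) Fin.zero    eq = contradiction (sym eq) (All.lookup p (∈-lookup i))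
  lookup-injective (_ ∷ u)  (Fin.suc i) (Fin.suc j) eq = cong Fin.suc (lookup-injective u i j eq)

module _ {A B : Set} (R : A → B → Set) where

  length-≤ : ∀ {xs ys} → Unique xs →
    (∀ {x} → x ∈ xs → ∃ λ y → y ∈ ys × R x y) →
    (∀ {x x′ y} → x ∈ xs → x′ ∈ xs → R x y → R x′ y → x ≡ x′) →
    length xs ≤ length ys
  length-≤ {xs} {ys} unique image injective = injective⇒≤ position-injective
    where
    partner : ∀ i → ∃ λ y → y ∈ ys × R (List.lookup xs i) y
    partner i = image (∈-lookup i)

    position : Fin (length xs) → Fin (length ys)
    position i = Any.index (proj₁ (proj₂ (partner i)))

    position-injective : ∀ {i j} → position i ≡ position j → i ≡ j
    position-injective {i} {j} eq = lookup-injective unique i j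
      (injective (∈-lookup i) (∈-lookup j) (proj₂ (proj₂ (partner i)))
        (subst (R _) (sym partners≡) (proj₂ (proj₂ (partner j)))))
      where
      partners≡ : proj₁ (partner i) ≡ proj₁ (partner j)
      partners≡ = trans (lookup-index (proj₁ (proj₂ (partner i))))
        (trans (cong (List.lookup ys) eq) (sym (lookup-index (proj₁ (proj₂ (partner j))))))

module _ {A B : Set} {P : Pred A 0ℓ} {Q : Pred B 0ℓ} (P? : Decidable P) (Q? : Decidable Q) (R : A → B → Set) where

  length-filter-≤ : ∀ {xs ys} → Unique xs → (∀ {y} → Q y → y ∈ ys) →
    (∀ x → P x → ∃ λ y → Q y × R x y) →
    (∀ {x x′} y → P x → P x′ → R x y → R x′ y → x ≡ x′) →
    length (filter P? xs) ≤ length (filter Q? ys)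
  length-filter-≤ {xs} {ys} unique complete image injective =
    length-≤ R {filter P? xs} {filter Q? ys} (Unique.filter⁺ P? unique)
    (λ x∈ → let (y , q , r) = image _ (holds x∈) in y , ∈-filter⁺ Q? (complete q) q , r)
    (λ x∈ x′∈ → injective _ (holds x∈) (holds x′∈))
    where
    holds : ∀ {x} → x ∈ filter P? xs → P x
    holds x∈ = proj₂ (∈-filter⁻ P? {xs = xs} x∈)

module _ {A : Set} where

  vectorsOver : List A → (m : ℕ) → List (Vec A m)
  vectorsOver xs zero    = [] ∷ []
  vectorsOver xs (suc m) = cartesianProductWith _∷_ xs (vectorsOver xs m)

  vectorsOver-unique : ∀ {xs} → Unique xs → ∀ m → Unique (vectorsOver xs m)
  vectorsOver-unique u zero    = All.[] ∷ []
  vectorsOver-unique u (suc m) =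
    Unique.cartesianProductWith⁺ _∷_ ∷-injective u (vectorsOver-unique u m)

  ∈-vectorsOver : ∀ {xs m} {v : Vec A m} → VAll.All (_∈ xs) v → v ∈ vectorsOver xs m
  ∈-vectorsOver []       = here refl
  ∈-vectorsOver (p ∷ ps) = ∈-cartesianProductWith⁺ _∷_ p (∈-vectorsOver ps)

concatMap-∷ : ∀ {A : Set} {m} (xs : List A) (vs : List (Vec A m)) →
  concatMap (λ x → map (x ∷_) vs) xs ≡ cartesianProductWith _∷_ xs vs
concatMap-∷ []       vs = refl
concatMap-∷ (x ∷ xs) vs = cong (map (x ∷_) vs List.++_) (concatMap-∷ xs vs)

allVecs≡ : ∀ c m → allVecs c m ≡ vectorsOver (upTo (suc c)) m
allVecs≡ c zero    = refl
allVecs≡ c (suc m) rewrite allVecs≡ c m = concatMap-∷ (upTo (suc c)) _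

-- allArrays is defined by a local function that cannot be named from here; the goal of allArrays≡
-- determines it by unification.
mutual
  allVecsOf : ∀ {A : Set} → ℕ → List A → (m : ℕ) → List (Vec A m)
  allVecsOf = _

  allArrays≡ : ∀ n c → allArrays n c ≡ vectorsOver (allVecs c n) n
  allArrays≡ n c with Vec ℕ n | allVecs c n
  ... | A | xs = allVecsOf≡ c xs n

  allVecsOf≡ : ∀ {A : Set} c (xs : List A) m → allVecsOf c xs m ≡ vectorsOver xs m
  allVecsOf≡ c xs zero    = refl
  allVecsOf≡ c xs (suc m) =
    trans (concatMap-∷ xs (allVecsOf c xs m)) (cong (cartesianProductWith _∷_ xs) (allVecsOf≡ c xs m))

allArrays-unique : ∀ n c → Unique (allArrays n c)
allArrays-unique n c rewrite allArrays≡ n c | allVecs≡ c n =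
  vectorsOver-unique (vectorsOver-unique (Unique.upTo⁺ (suc c)) n) n

∈-allArrays : ∀ {n c} {π : Array n} → (∀ i j → entry π i j ≤ c) → π ∈ allArrays n c
∈-allArrays {n} {c} {π} bounded rewrite allArrays≡ n c | allVecs≡ c n =
  ∈-vectorsOver (all⁺ λ i → ∈-vectorsOver (all⁺ λ j → ∈-upTo⁺ (s≤s (bounded i j))))
  where
  all⁺ : ∀ {A : Set} {P : Pred A 0ℓ} {m} {v : Vec A m} → (∀ i → P (Vec.lookup v i)) → VAll.All P v
  all⁺ {v = []}    p = []
  all⁺ {v = _ ∷ _} p = p Fin.zero ∷ all⁺ (λ i → p (Fin.suc i))

-- Stripping a 0-1 vector from a triangle

-- The column added last has the entries w₁ₙ, …, wₙₙ of the upper half of a symmetric matrix.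
data Triangle : ℕ → Set where
  ε   : Triangle 0
  _▹_ : ∀ {n} → Triangle n → Vec ℕ (suc n) → Triangle (suc n)

infixl 5 _▹_

-- Sweep x b w b′ w′: a bit x travels down the column w and meets the bits b arriving from the left.
-- At an entry u, bits 1, 1 annihilate and leave u + 1, while bits 0, 0 become 1, 1 at the cost of
-- one unit of u if u > 0; unequal bits pass. On the diagonal the bit arriving from the left is x
-- itself, by symmetry.
data Sweep : ∀ {n} → Bool → Vec Bool n → Vec ℕ (suc n) → Vec Bool (suc n) → Vec ℕ (suc n) → Set where
  idle₀  : Sweep false [] (0 ∷ []) (false ∷ []) (0 ∷ [])
  birth₀ : ∀ {u} → Sweep false [] (suc u ∷ []) (true ∷ []) (u ∷ [])
  death₀ : ∀ {u} → Sweep true [] (u ∷ []) (false ∷ []) (suc u ∷ [])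
  idle   : ∀ {n} {b : Vec Bool n} {w b′ w′} → Sweep false b w b′ w′ →
           Sweep false (false ∷ b) (0 ∷ w) (false ∷ b′) (0 ∷ w′)
  birth  : ∀ {n u} {b : Vec Bool n} {w b′ w′} → Sweep true b w b′ w′ →
           Sweep false (false ∷ b) (suc u ∷ w) (true ∷ b′) (u ∷ w′)
  down   : ∀ {n u} {b : Vec Bool n} {w b′ w′} → Sweep true b w b′ w′ →
           Sweep true (false ∷ b) (u ∷ w) (false ∷ b′) (u ∷ w′)
  across : ∀ {n u} {b : Vec Bool n} {w b′ w′} → Sweep false b w b′ w′ →
           Sweep false (true ∷ b) (u ∷ w) (true ∷ b′) (u ∷ w′)
  death  : ∀ {n u} {b : Vec Bool n} {w b′ w′} → Sweep false b w b′ w′ →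
           Sweep true (true ∷ b) (u ∷ w) (false ∷ b′) (suc u ∷ w′)

sweep : ∀ {n} x (b : Vec Bool n) w → ∃₂ λ b′ w′ → Sweep x b w b′ w′
sweep false []          (zero ∷ [])  = _ , _ , idle₀
sweep false []          (suc u ∷ []) = _ , _ , birth₀
sweep true  []          (u ∷ [])     = _ , _ , death₀
sweep false (false ∷ b) (zero ∷ w)   = let (_ , _ , s) = sweep false b w in _ , _ , idle s
sweep false (false ∷ b) (suc u ∷ w)  = let (_ , _ , s) = sweep true b w in _ , _ , birth s
sweep true  (false ∷ b) (u ∷ w)      = let (_ , _ , s) = sweep true b w in _ , _ , down s
sweep false (true ∷ b)  (u ∷ w)      = let (_ , _ , s) = sweep false b w in _ , _ , across s
sweep true  (true ∷ b)  (u ∷ w)      = let (_ , _ , s) = sweep false b w in _ , _ , death s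

-- An entry can be restored only once the bit leaving it downward is known, so the column is undone
-- from the diagonal upward. The bit entering at the top is an output and may well be 1, in which
-- case the sweep cannot occur in a `Peel`.
unsweep : ∀ {n} (b′ : Vec Bool (suc n)) w′ → ∃ λ x → ∃₂ λ b w → Sweep x b w b′ w′
unsweep {zero}  (false ∷ []) (zero ∷ [])  = _ , _ , _ , idle₀
unsweep {zero}  (false ∷ []) (suc u ∷ []) = _ , _ , _ , death₀
unsweep {zero}  (true ∷ [])  (u ∷ [])     = _ , _ , _ , birth₀
unsweep {suc n} (c ∷ b′)     (u ∷ w′) with unsweep b′ w′
unsweep {suc n} (false ∷ _) (zero ∷ _)  | false , _ , _ , s = _ , _ , _ , idle s
unsweep {suc n} (false ∷ _) (suc _ ∷ _) | false , _ , _ , s = _ , _ , _ , death s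
unsweep {suc n} (true ∷ _)  (_ ∷ _)     | false , _ , _ , s = _ , _ , _ , across s
unsweep {suc n} (false ∷ _) (_ ∷ _)     | true  , _ , _ , s = _ , _ , _ , down s
unsweep {suc n} (true ∷ _)  (_ ∷ _)     | true  , _ , _ , s = _ , _ , _ , birth s

sweep-functional : ∀ {n x} {b : Vec Bool n} {w b₁ w₁ b₂ w₂} →
  Sweep x b w b₁ w₁ → Sweep x b w b₂ w₂ → b₁ ≡ b₂ × w₁ ≡ w₂
sweep-functional idle₀      idle₀      = refl , refl
sweep-functional birth₀     birth₀     = refl , refl
sweep-functional death₀     death₀     = refl , refl
sweep-functional (idle s)   (idle t)   with refl , refl ← sweep-functional s t = refl , refl
sweep-functional (birth s)  (birth t)  with refl , refl ← sweep-functional s t = refl , refl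
sweep-functional (down s)   (down t)   with refl , refl ← sweep-functional s t = refl , refl
sweep-functional (across s) (across t) with refl , refl ← sweep-functional s t = refl , refl
sweep-functional (death s)  (death t)  with refl , refl ← sweep-functional s t = refl , refl

sweep-injective : ∀ {n x₁ x₂} {b₁ b₂ : Vec Bool n} {w₁ w₂ b′ w′} →
  Sweep x₁ b₁ w₁ b′ w′ → Sweep x₂ b₂ w₂ b′ w′ → x₁ ≡ x₂ × b₁ ≡ b₂ × w₁ ≡ w₂
sweep-injective idle₀      idle₀      = refl , refl , refl
sweep-injective birth₀     birth₀     = refl , refl , refl
sweep-injective death₀     death₀     = refl , refl , refl
sweep-injective (idle s)   (idle t)   with refl , refl , refl ← sweep-injective s t = refl , refl , refl
sweep-injective (birth s)  (birth t)  with refl , refl , refl ← sweep-injective s t = refl , refl , refl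
sweep-injective (down s)   (down t)   with refl , refl , refl ← sweep-injective s t = refl , refl , refl
sweep-injective (across s) (across t) with refl , refl , refl ← sweep-injective s t = refl , refl , refl
sweep-injective (death s)  (death t)  with refl , refl , refl ← sweep-injective s t = refl , refl , refl
-- In the remaining pairs both rules emit the same bit to the right but different bits downward, and
-- the induction hypothesis determines the latter.
sweep-injective (idle s)   (down t)   with () ← proj₁ (sweep-injective s t)
sweep-injective (down s)   (idle t)   with () ← proj₁ (sweep-injective s t)
sweep-injective (birth s)  (across t) with () ← proj₁ (sweep-injective s t)
sweep-injective (across s) (birth t)  with () ← proj₁ (sweep-injective s t)
sweep-injective (down s)   (death t)  with () ← proj₁ (sweep-injective s t)
sweep-injective (death s)  (down t)   with () ← proj₁ (sweep-injective s t)

data Peel : ∀ {n} → Triangle n → Vec Bool n → Triangle n → Set where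
  ε   : Peel ε [] ε
  _▹_ : ∀ {n} {T T′ : Triangle n} {b w b′ w′} →
        Peel T b T′ → Sweep false b w b′ w′ → Peel (T ▹ w) b′ (T′ ▹ w′)

peel : ∀ {n} (T : Triangle n) → ∃₂ λ b T′ → Peel T b T′
peel ε       = _ , _ , ε
peel (T ▹ w) = let (b , _ , p) = peel T ; (_ , _ , s) = sweep false b w in _ , _ , p ▹ s

peel-functional : ∀ {n} {T : Triangle n} {b₁ T₁ b₂ T₂} →
  Peel T b₁ T₁ → Peel T b₂ T₂ → b₁ ≡ b₂ × T₁ ≡ T₂
peel-functional ε       ε       = refl , refl
peel-functional (p ▹ s) (q ▹ t) with refl , refl ← peel-functional p q
                                 with refl , refl ← sweep-functional s t = refl , refl

peel-injective : ∀ {n} {T₁ T₂ : Triangle n} {b T′} → Peel T₁ b T′ → Peel T₂ b T′ → T₁ ≡ T₂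
peel-injective ε       ε       = refl
peel-injective (p ▹ s) (q ▹ t) with _ , refl , refl ← sweep-injective s t
                                with refl ← peel-injective p q = refl

-- Dominance between consecutively stripped vectors

-- Dominates d b c: every prefix sum of c is at most d plus that of b.
data Dominates : ℕ → ∀ {n} → Vec Bool n → Vec Bool n → Set where
  []   : ∀ {d} → Dominates d [] []
  same : ∀ {d n x} {b c : Vec Bool n} → Dominates d b c → Dominates d (x ∷ b) (x ∷ c)
  gain : ∀ {d n} {b c : Vec Bool n} → Dominates (suc d) b c → Dominates d (true ∷ b) (false ∷ c)
  loss : ∀ {d n} {b c : Vec Bool n} → Dominates d b c → Dominates (suc d) (false ∷ b) (true ∷ c)

-- Balance e z d x: e + z = d + x.
data Balance : ℕ → Bool → ℕ → Bool → Set where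
  level : ∀ {d x} → Balance d x d x
  above : ∀ {d} → Balance (suc d) false d true
  below : ∀ {d} → Balance d true (suc d) false

-- At every entry the bit moving right and the bit moving down change by the same amount. Hence the
-- margin of `b′` over `c′` after a row, allowance included, is that of `b` over `c` plus the
-- difference of the two bits then travelling down; `Balance` keeps this account. A deficit could
-- only start where the first sweep idles and the second gives birth, and `idle` leaves an entry 0,
-- which allows no birth.
sweep-dominates : ∀ {n x z d e} {b c : Vec Bool n} {w b′ w′ c′ w″} →
  Sweep x b w b′ w′ → Sweep z c w′ c′ w″ → Balance e z d x → Dominates d b c → Dominates e b′ c′
sweep-dominates idle₀      idle₀      level []       = same []
sweep-dominates idle₀      death₀     below []       = same []
sweep-dominates birth₀     idle₀      level []       = gain []
sweep-dominates birth₀     birth₀     level []       = same []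
sweep-dominates birth₀     death₀     below []       = gain []
sweep-dominates death₀     birth₀     above []       = loss []
sweep-dominates death₀     death₀     level []       = same []
sweep-dominates (idle s)   (idle t)   level (same m) = same (sweep-dominates s t level m)
sweep-dominates (idle s)   (down t)   below (same m) = same (sweep-dominates s t below m)
sweep-dominates (idle s)   (across t) level (loss m) = loss (sweep-dominates s t level m)
sweep-dominates (idle s)   (death t)  below (loss m) = same (sweep-dominates s t level m)
sweep-dominates (birth s)  (idle t)   level (same m) = gain (sweep-dominates s t above m)
sweep-dominates (birth s)  (birth t)  level (same m) = same (sweep-dominates s t level m)
sweep-dominates (birth s)  (down t)   below (same m) = gain (sweep-dominates s t level m)
sweep-dominates (birth s)  (across t) level (loss m) = same (sweep-dominates s t above m)
sweep-dominates (birth s)  (death t)  below (loss m) = gain (sweep-dominates s t above m)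
sweep-dominates (down s)   (idle t)   above (same m) = same (sweep-dominates s t above m)
sweep-dominates (down s)   (birth t)  above (same m) = loss (sweep-dominates s t level m)
sweep-dominates (down s)   (down t)   level (same m) = same (sweep-dominates s t level m)
sweep-dominates (down s)   (across t) above (loss m) = loss (sweep-dominates s t above m)
sweep-dominates (down s)   (death t)  level (loss m) = same (sweep-dominates s t above m)
sweep-dominates (across s) (idle t)   level (gain m) = gain (sweep-dominates s t level m)
sweep-dominates (across s) (birth t)  level (gain m) = same (sweep-dominates s t below m)
sweep-dominates (across s) (down t)   below (gain m) = gain (sweep-dominates s t below m)
sweep-dominates (across s) (across t) level (same m) = same (sweep-dominates s t level m)
sweep-dominates (across s) (death t)  below (same m) = gain (sweep-dominates s t level m)
sweep-dominates (death s)  (birth t)  above (gain m) = loss (sweep-dominates s t below m)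
sweep-dominates (death s)  (down t)   level (gain m) = same (sweep-dominates s t below m)
sweep-dominates (death s)  (across t) above (same m) = loss (sweep-dominates s t level m)
sweep-dominates (death s)  (death t)  level (same m) = same (sweep-dominates s t level m)

-- The account of `sweep-dominates` now determines `d`, which would be negative only for `e = 0`,
-- `x = true`, `z = false`. Such a deficit would pass down the column through `down` and `idle`
-- until a `death` meets an `idle`, but a death leaves a positive entry, where the second sweep
-- cannot idle.
unsweep-dominates : ∀ {n x z e} {b c : Vec Bool n} {w b′ w′ c′ w″} →
  Sweep x b w b′ w′ → Sweep z c w′ c′ w″ → Dominates e b′ c′ →
  ∃ λ d → Balance e z d x × Dominates d b c
unsweep-dominates idle₀      idle₀      (same []) = _ , level , []
unsweep-dominates idle₀      death₀     (same []) = _ , below , []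
unsweep-dominates birth₀     idle₀      (gain []) = _ , level , []
unsweep-dominates birth₀     birth₀     (same []) = _ , level , []
unsweep-dominates birth₀     death₀     (gain []) = _ , below , []
unsweep-dominates death₀     birth₀     (loss []) = _ , above , []
unsweep-dominates death₀     death₀     (same []) = _ , level , []
unsweep-dominates (idle s)   (idle t)   (same m)  with _ , level , m′ ← unsweep-dominates s t m = _ , level , same m′
unsweep-dominates (idle s)   (down t)   (same m)  with _ , below , m′ ← unsweep-dominates s t m = _ , below , same m′
unsweep-dominates (idle s)   (across t) (loss m)  with _ , level , m′ ← unsweep-dominates s t m = _ , level , loss m′
unsweep-dominates (idle s)   (death t)  (same m)  with _ , level , m′ ← unsweep-dominates s t m = _ , below , loss m′
unsweep-dominates (birth s)  (idle t)   (gain m)  with _ , above , m′ ← unsweep-dominates s t m = _ , level , same m′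
unsweep-dominates (birth s)  (birth t)  (same m)  with _ , level , m′ ← unsweep-dominates s t m = _ , level , same m′
unsweep-dominates (birth s)  (down t)   (gain m)  with _ , level , m′ ← unsweep-dominates s t m = _ , below , same m′
unsweep-dominates (birth s)  (across t) (same m)  with _ , above , m′ ← unsweep-dominates s t m = _ , level , loss m′
unsweep-dominates (birth s)  (death t)  (gain m)  with _ , above , m′ ← unsweep-dominates s t m = _ , below , loss m′
unsweep-dominates (down s)   (idle t)   (same m)  with _ , above , m′ ← unsweep-dominates s t m = _ , above , same m′
unsweep-dominates (down s)   (birth t)  (loss m)  with _ , level , m′ ← unsweep-dominates s t m = _ , above , same m′
unsweep-dominates (down s)   (down t)   (same m)  with _ , level , m′ ← unsweep-dominates s t m = _ , level , same m′
unsweep-dominates (down s)   (across t) (loss m)  with _ , above , m′ ← unsweep-dominates s t m = _ , above , loss m′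
unsweep-dominates (down s)   (death t)  (same m)  with _ , above , m′ ← unsweep-dominates s t m = _ , level , loss m′
unsweep-dominates (across s) (idle t)   (gain m)  with _ , level , m′ ← unsweep-dominates s t m = _ , level , gain m′
unsweep-dominates (across s) (birth t)  (same m)  with _ , below , m′ ← unsweep-dominates s t m = _ , level , gain m′
unsweep-dominates (across s) (down t)   (gain m)  with _ , below , m′ ← unsweep-dominates s t m = _ , below , gain m′
unsweep-dominates (across s) (across t) (same m)  with _ , level , m′ ← unsweep-dominates s t m = _ , level , same m′
unsweep-dominates (across s) (death t)  (gain m)  with _ , level , m′ ← unsweep-dominates s t m = _ , below , same m′
unsweep-dominates (death s)  (birth t)  (loss m)  with _ , below , m′ ← unsweep-dominates s t m = _ , above , gain m′
unsweep-dominates (death s)  (down t)   (same m)  with _ , below , m′ ← unsweep-dominates s t m = _ , level , gain m′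
unsweep-dominates (death s)  (across t) (loss m)  with _ , level , m′ ← unsweep-dominates s t m = _ , above , same m′
unsweep-dominates (death s)  (death t)  (same m)  with _ , level , m′ ← unsweep-dominates s t m = _ , level , same m′

-- Path weights

top : ∀ {n} → Vec ℕ n → ℕ
top []      = 0
top (h ∷ _) = h

-- Entry s becomes the maximal weight of a path through the symmetric matrix from (s, n) to (n, s).
-- By symmetry it suffices to follow paths to the diagonal and count off-diagonal entries twice.
extend : ∀ {n} → Vec ℕ n → Vec ℕ (suc n) → Vec ℕ (suc n)
extend []       (w ∷ [])  = w ∷ []
extend (h ∷ hs) (w ∷ ws) = w + (w + (h ⊔ top (extend hs ws))) ∷ extend hs ws

heights : ∀ {n} → Triangle n → Vec ℕ n
heights ε       = []
heights (T ▹ w) = extend (heights T) w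

firstLine : ∀ {n} → Vec Bool n → Vec ℕ n → ℕ
firstLine []          []       = 0
firstLine (true ∷ _)  (h ∷ _)  = h
firstLine (false ∷ b) (_ ∷ hs) = firstLine b hs

-- Compares the heights h before and g after stripping: g = h - 1 where the stripped bit is 1 (line),
-- while elsewhere (gap) g may differ from h by one either way, controlled by the nearest lines:
-- k is g at the previous line and ℓ is h at the next line, or 0 if there is none.
record Near (k ℓ h g : ℕ) : Set where
  constructor near
  field
    g≤1+h : g ≤ suc h
    h≤1+g : h ≤ suc g
    g≤    : g ≤ k ⊔ pred h
    h≤    : h ≤ ℓ ⊔ pred g

data Shifted : ∀ {n} → ℕ → Vec Bool n → Vec ℕ n → Vec ℕ n → Set where
  []   : ∀ {k} → Shifted k [] [] []
  line : ∀ {k n g} {b : Vec Bool n} {hs gs} → Shifted g b hs gs →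
         Shifted k (true ∷ b) (suc g ∷ hs) (g ∷ gs)
  gap  : ∀ {k n h g} {b : Vec Bool n} {hs gs} → Near k (firstLine b hs) h g → Shifted k b hs gs →
         Shifted k (false ∷ b) (h ∷ hs) (g ∷ gs)

lineAt : ∀ {k n h g} {b : Vec Bool n} {hs gs} → suc g ≡ h → Shifted g b hs gs →
  Shifted k (true ∷ b) (h ∷ hs) (g ∷ gs)
lineAt refl = line

near-mono : ∀ {k k′ ℓ ℓ′ h g} → k ≤ k′ → ℓ ≤ ℓ′ → Near k ℓ h g → Near k′ ℓ′ h g
near-mono k≤k′ ℓ≤ℓ′ (near p q r s) =
  near p q (≤-trans r (⊔-monoˡ-≤ _ k≤k′)) (≤-trans s (⊔-monoˡ-≤ _ ℓ≤ℓ′))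

near-⊔ : ∀ {k ℓ h₁ g₁ h₂ g₂} → Near k ℓ h₁ g₁ → Near k ℓ h₂ g₂ → Near k ℓ (h₁ ⊔ h₂) (g₁ ⊔ g₂)
near-⊔ {k} {ℓ} {h₁} {g₁} {h₂} {g₂} (near p₁ q₁ r₁ s₁) (near p₂ q₂ r₂ s₂) = near
  (⊔-mono-≤ p₁ p₂) (⊔-mono-≤ q₁ q₂)
  (⊔-lub (≤-trans r₁ (⊔-monoʳ-≤ k (pred-mono-≤ (m≤m⊔n h₁ h₂)))) (≤-trans r₂ (⊔-monoʳ-≤ k (pred-mono-≤ (m≤n⊔m h₁ h₂)))))
  (⊔-lub (≤-trans s₁ (⊔-monoʳ-≤ ℓ (pred-mono-≤ (m≤m⊔n g₁ g₂)))) (≤-trans s₂ (⊔-monoʳ-≤ ℓ (pred-mono-≤ (m≤n⊔m g₁ g₂)))))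

near-suc : ∀ {k ℓ h} → h < k → Near k ℓ h (suc h)
near-suc {k} {ℓ} {h} h<k = near ≤-refl (m≤n+m h 2) (≤-trans h<k (m≤m⊔n k _)) (m≤n⊔m ℓ h)

near-top : ∀ {k n} {b : Vec Bool (suc n)} {hs gs} → Shifted k b hs gs →
  Near k (firstLine b hs) (top hs) (top gs)
near-top {k} (line {g = g} _) = near (m≤n+m g 2) ≤-refl (m≤n⊔m k g) (m≤m⊔n (suc g) (pred g))
near-top (gap p _)  = p

-- If the new top exceeds the old top minus one, `Near` bounds it by the height `g` of the preceding
-- line, so the maximum with `g` does not notice it.
line-⊔ : ∀ {n g} {b : Vec Bool (suc n)} {hs gs} → Shifted g b hs gs →
  suc g ⊔ top hs ≡ suc (g ⊔ top gs)
line-⊔ {g = k} (line _) = refl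
line-⊔ {g = k} (gap {h = h} {g = g} (near _ h≤1+g g≤ _) _) = ≤-antisym
  (⊔-mono-≤ (≤-refl {suc k}) h≤1+g)
  (⊔-lub (m≤m⊔n (suc k) h) (≤-trans (s≤s g≤) (suc-⊔-pred h)))
  where
  suc-⊔-pred : ∀ h → suc (k ⊔ pred h) ≤ suc k ⊔ h
  suc-⊔-pred zero    = s≤s (≤-reflexive (⊔-identityʳ k))
  suc-⊔-pred (suc h) = ≤-refl

-- The counterpart of `line-⊔` below a travelling bit: if `h` exceeds `pred g`, then `h` is at most
-- the next line `ℓ`, hence at most `t`, and disappears in the maximum.
gap-⊔ : ∀ {k ℓ h g t} → Near k ℓ h g → ℓ ≤ t → g ⊔ suc t ≡ suc (h ⊔ t)
gap-⊔ {ℓ = ℓ} {h} {g} {t} (near g≤1+h _ _ h≤) ℓ≤t = ≤-antisym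
  (⊔-mono-≤ g≤1+h (≤-refl {suc t}))
  (⊔-lub (≤-trans (s≤s h≤) (suc-⊔-pred g)) (m≤n⊔m g (suc t)))
  where
  suc-⊔-pred : ∀ g → suc (ℓ ⊔ pred g) ≤ g ⊔ suc t
  suc-⊔-pred zero    = s≤s (≤-trans (≤-reflexive (⊔-identityʳ ℓ)) ℓ≤t)
  suc-⊔-pred (suc g) = s≤s (≤-trans (⊔-monoˡ-≤ g ℓ≤t) (≤-reflexive (⊔-comm t g)))

module _ {n : ℕ} (h w : ℕ) (hs : Vec ℕ n) (ws : Vec ℕ (suc n)) where

  private
    m≤w+[w+m] : ∀ m → m ≤ w + (w + m)
    m≤w+[w+m] m = ≤-trans (m≤n+m m w) (m≤n+m (w + m) w)

  h≤extend : h ≤ top (extend (h ∷ hs) (w ∷ ws))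
  h≤extend = ≤-trans (m≤m⊔n h _) (m≤w+[w+m] _)

  tail≤extend : top (extend hs ws) ≤ top (extend (h ∷ hs) (w ∷ ws))
  tail≤extend = ≤-trans (m≤n⊔m h _) (m≤w+[w+m] _)

firstLine≤extend : ∀ {n} (b : Vec Bool n) hs ws → firstLine b hs ≤ top (extend hs ws)
firstLine≤extend []          []       (w ∷ []) = z≤n
firstLine≤extend (true ∷ b)  (h ∷ hs) (w ∷ ws) = h≤extend h w hs ws
firstLine≤extend (false ∷ b) (h ∷ hs) (w ∷ ws) =
  ≤-trans (firstLine≤extend b hs ws) (tail≤extend h w hs ws)

-- With no bit travelling down, the first 1 of `b` either crosses the column or has a birth above
-- it, so the next line never moves down. Paths may descend before turning left, so the height there
-- is at least the old one.
firstLine-sweep : ∀ {n} {b : Vec Bool n} {w b′ w′} hs → Sweep false b w b′ w′ →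
  firstLine b hs ≤ firstLine b′ (extend hs w)
firstLine-sweep []       idle₀      = z≤n
firstLine-sweep []       birth₀     = z≤n
firstLine-sweep (h ∷ hs) (idle s)   = firstLine-sweep hs s
firstLine-sweep (h ∷ hs) (birth {u = u} {b} {w} s) =
  ≤-trans (firstLine≤extend b hs w) (tail≤extend h (suc u) hs w)
firstLine-sweep (h ∷ hs) (across {u = u} {w = w} s) = h≤extend h u hs w

double-suc : ∀ u m → suc (u + (u + m)) ≡ u + (u + suc m)
double-suc u m = trans (sym (+-suc u (u + m))) (cong (u +_) (sym (+-suc u m)))

-- The requirement on `k′`, the new height at the preceding line of the extended column. Under a
-- travelling bit that line is its birth, and every height down to its death rises by one; `t` is
-- the height before stripping where the bit arrives, so `k′` must exceed `t` to cover the raised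
-- values.
Carry : Bool → ℕ → ℕ → ℕ → Set
Carry false k k′ _ = k ≤ k′
Carry true  _ k′ t = t < k′

mutual
  -- Off the diagonal a death adds two to the path weight while the maximum it extends drops by one,
  -- and a bit that passes inherits the rise from below. In `sweep-shifted` a birth conversely
  -- removes two and regains one from below, which makes its row a line.
  sweep-top : ∀ {n k} {b : Vec Bool n} {w b′ w′ hs gs} → Sweep true b w b′ w′ →
    Shifted k b hs gs → top (extend gs w′) ≡ suc (top (extend hs w))
  sweep-top death₀ [] = refl
  sweep-top (down {u = u} {b} {w} s) (gap {hs = hs} p i)
    rewrite sweep-top s i | gap-⊔ p (firstLine≤extend b hs w) = sym (double-suc u _)
  sweep-top (death {u = u} s) (line {g = g} {hs = hs} {gs} i)
    rewrite line-⊔ (sweep-shifted s i ≤-refl) =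
      cong suc (trans (+-suc u _) (double-suc u _))

  sweep-shifted : ∀ {n x k k′} {b : Vec Bool n} {w b′ w′ hs gs} → Sweep x b w b′ w′ →
    Shifted k b hs gs → Carry x k k′ (top (extend hs w)) → Shifted k′ b′ (extend hs w) (extend gs w′)
  sweep-shifted idle₀  [] _   = gap (near z≤n z≤n z≤n z≤n) []
  sweep-shifted birth₀ [] _   = line []
  sweep-shifted death₀ [] u<k = gap (near-suc u<k) []
  sweep-shifted (idle s) (gap {hs = hs} p i) k≤k′ =
    gap (near-⊔ (near-mono k≤k′ (firstLine-sweep hs s) p) (near-top i′)) i′
    where i′ = sweep-shifted s i k≤k′
  sweep-shifted (birth {u = u} {b} {w} {b′} {w′} s) (gap {h = h} {g} {hs = hs} {gs} p i) _ =
    lineAt lifted (sweep-shifted s i (≤-trans (≤-reflexive (sym eq)) (tail≤extend g u gs w′)))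
    where
    eq = sweep-top s i
    lifted : suc (u + (u + (g ⊔ top (extend gs w′)))) ≡ suc u + (suc u + (h ⊔ top (extend hs w)))
    lifted rewrite eq | gap-⊔ p (firstLine≤extend b hs w) =
      cong suc (cong (u +_) (+-suc u _))
  sweep-shifted (down {u = u} {w = w} s) (gap {h = h} {hs = hs} p i) t<k′
    rewrite sweep-top (down {u = u} s) (gap p i) =
      gap (near-suc t<k′) (sweep-shifted s i (≤-<-trans (tail≤extend h u hs w) t<k′))
  sweep-shifted (across {u = u} {w = w} {w′ = w′} s) (line {g = g} {hs = hs} {gs} i) _ =
    lineAt lifted (sweep-shifted s i (h≤extend g u gs w′))
    where
    lifted : suc (u + (u + (g ⊔ top (extend gs w′)))) ≡ u + (u + (suc g ⊔ top (extend hs w)))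
    lifted rewrite line-⊔ (sweep-shifted s i ≤-refl) = double-suc u _
  sweep-shifted (death {u = u} {w = w} s) (line {g = g} {hs = hs} i) t<k′
    rewrite sweep-top {k = 0} (death {u = u} s) (line i) =
      gap (near-suc t<k′) (sweep-shifted s i
        (≤-trans (≤-trans (n≤1+n g) (h≤extend (suc g) u hs w)) (<⇒≤ t<k′)))

peel-shifted : ∀ {n} {T : Triangle n} {b T′} → Peel T b T′ → Shifted 0 b (heights T) (heights T′)
peel-shifted ε       = []
peel-shifted (p ▹ s) = sweep-shifted s (peel-shifted p) z≤n

peel-height : ∀ {n} {T : Triangle n} {b T′} → Peel T b T′ → top (heights T′) ≡ pred (top (heights T))
peel-height p = helper (peel-shifted p)
  where
  helper : ∀ {n} {b : Vec Bool n} {hs gs} → Shifted 0 b hs gs → top gs ≡ pred (top hs)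
  helper []       = refl
  helper (line _) = refl
  -- No line precedes the top row, so `k` is 0 and the upper bound on the new height is `pred` of
  -- the old one.
  helper (gap (near _ h≤1+g g≤ _) _) = ≤-antisym g≤ (pred-mono-≤ h≤1+g)

-- Chains of dominating vectors

peel-dominates : ∀ {n} {T T′ T″ : Triangle n} {b c} → Peel T b T′ → Peel T′ c T″ → Dominates 0 b c
peel-dominates ε       ε       = []
peel-dominates (p ▹ s) (q ▹ t) = sweep-dominates s t level (peel-dominates p q)

unpeel : ∀ {n} {T′ T″ : Triangle n} {b c} → Peel T′ c T″ → Dominates 0 b c → ∃ λ T → Peel T b T′
unpeel ε       []  = ε , ε
unpeel {T′ = _ ▹ w′} {b = b} (q ▹ t) dom
  with _ , _ , _ , s ← unsweep b w′
  -- With allowance 0 and no bit entering `t`, the only possible balance is `level`; this forces the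
  -- bit that `unsweep` found at the top to be 0.
  with _ , level , dom′ ← unsweep-dominates s t dom
  with _ , p ← unpeel q dom′ = _ , p ▹ s

zeros : ∀ n → Triangle n
zeros zero    = ε
zeros (suc n) = zeros n ▹ replicate (suc n) 0

sweep-zeros : ∀ n →
  Sweep false (replicate n false) (replicate (suc n) 0) (replicate (suc n) false) (replicate (suc n) 0)
sweep-zeros zero    = idle₀
sweep-zeros (suc n) = idle (sweep-zeros n)

peel-zeros : ∀ n → Peel (zeros n) (replicate n false) (zeros n)
peel-zeros zero    = ε
peel-zeros (suc n) = peel-zeros n ▹ sweep-zeros n

extend≡0 : ∀ {n} (h : Vec ℕ n) w → top (extend h w) ≤ 0 → top h ≤ 0 × w ≡ replicate (suc n) 0
extend≡0 []       (zero ∷ []) _  = z≤n , refl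
extend≡0 (h ∷ hs) (zero ∷ ws) le =
  ≤-trans (m≤m⊔n h _) le ,
  cong (0 ∷_) (proj₂ (extend≡0 hs ws (≤-trans (m≤n⊔m h _) le)))

heights≡0 : ∀ {n} (T : Triangle n) → top (heights T) ≤ 0 → T ≡ zeros n
heights≡0 ε       _  = refl
heights≡0 (T ▹ w) le with le′ , refl ← extend≡0 (heights T) w le
                     with refl ← heights≡0 T le′ = refl

heights-zeros : ∀ n → heights (zeros n) ≡ replicate n 0
heights-zeros zero    = refl
heights-zeros (suc n) rewrite heights-zeros n = extend-zeros n
  where
  extend-zeros : ∀ n → extend (replicate n 0) (replicate (suc n) 0) ≡ replicate (suc n) 0
  extend-zeros zero    = refl
  extend-zeros (suc n) rewrite extend-zeros n = refl

top-replicate : ∀ n → top (replicate n 0) ≡ 0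
top-replicate zero    = refl
top-replicate (suc n) = refl

-- The zero vector is what stripping the zero triangle yields, so even the end of a chain has a next
-- step against which `unpeel` can test dominance.
strongest : ∀ {n c} → Vec (Vec Bool n) c → Vec Bool n
strongest []      = replicate _ false
strongest (b ∷ _) = b

data Descending {n} : ∀ {c} → Vec (Vec Bool n) c → Set where
  []  : Descending []
  _∷_ : ∀ {c b} {bs : Vec (Vec Bool n) c} → Dominates 0 b (strongest bs) → Descending bs → Descending (b ∷ bs)

data Peels {n} : ∀ {c} → Triangle n → Vec (Vec Bool n) c → Set where
  []  : Peels (zeros n) []
  _∷_ : ∀ {c T b T′} {bs : Vec (Vec Bool n) c} → Peel T b T′ → Peels T′ bs → Peels T (b ∷ bs)

peels-strongest : ∀ {n c} {T : Triangle n} {bs : Vec (Vec Bool n) c} → Peels T bs → ∃ (Peel T (strongest bs))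
peels-strongest []      = _ , peel-zeros _
peels-strongest (p ∷ _) = _ , p

peels : ∀ {n} c (T : Triangle n) → top (heights T) ≤ c →
  ∃ λ (bs : Vec (Vec Bool n) c) → Descending bs × Peels T bs
peels zero    T le rewrite heights≡0 T le = [] , [] , []
peels (suc c) T le
  with _ , T′ , p ← peel T
  with bs , desc , ps ← peels c T′ (≤-trans (≤-reflexive (peel-height p)) (pred-mono-≤ le))
  = _ , peel-dominates p (proj₂ (peels-strongest ps)) ∷ desc , p ∷ ps

unpeels : ∀ {n c} {bs : Vec (Vec Bool n) c} → Descending bs →
  ∃ λ T → top (heights T) ≤ c × Peels T bs
unpeels {n} [] = zeros n , ≤-reflexive (trans (cong top (heights-zeros n)) (top-replicate n)) , []
unpeels (dom ∷ desc)
  with T′ , le , ps ← unpeels desc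
  with T , p ← unpeel (proj₂ (peels-strongest ps)) dom
  = T , ≤-trans (suc-pred-≤ (top (heights T))) (s≤s (≤-trans (≤-reflexive (sym (peel-height p))) le)) , p ∷ ps
  where
  suc-pred-≤ : ∀ m → m ≤ suc (pred m)
  suc-pred-≤ zero    = z≤n
  suc-pred-≤ (suc m) = ≤-refl

peels-functional : ∀ {n c} {T : Triangle n} {bs bs′ : Vec (Vec Bool n) c} → Peels T bs → Peels T bs′ → bs ≡ bs′
peels-functional []       []       = refl
peels-functional (p ∷ ps) (q ∷ qs) with refl , refl ← peel-functional p q
                                   with refl ← peels-functional ps qs = refl

peels-injective : ∀ {n c} {T T′ : Triangle n} {bs : Vec (Vec Bool n) c} → Peels T bs → Peels T′ bs → T ≡ T′
peels-injective []       []       = refl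
peels-injective (p ∷ ps) (q ∷ qs) with refl ← peels-injective ps qs = peel-injective p q

-- Dominance as an inequality of prefix sums

prefix : ∀ {n} → Vec Bool n → ℕ → ℕ
prefix []          _       = 0
prefix (_ ∷ _)     zero    = 0
prefix (true ∷ b)  (suc k) = suc (prefix b k)
prefix (false ∷ b) (suc k) = prefix b k

prefix-zero : ∀ {n} (b : Vec Bool n) → prefix b 0 ≡ 0
prefix-zero []      = refl
prefix-zero (_ ∷ _) = refl

prefix-≤ : ∀ {n} (b : Vec Bool n) k → prefix b k ≤ k
prefix-≤ []          k       = z≤n
prefix-≤ (_ ∷ _)     zero    = z≤n
prefix-≤ (true ∷ b)  (suc k) = s≤s (prefix-≤ b k)
prefix-≤ (false ∷ b) (suc k) = m≤n⇒m≤1+n (prefix-≤ b k)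

prefix-mono : ∀ {n} (b : Vec Bool n) k → prefix b k ≤ prefix b (suc k)
prefix-mono []          k       = z≤n
prefix-mono (_ ∷ _)     zero    = z≤n
prefix-mono (true ∷ b)  (suc k) = s≤s (prefix-mono b k)
prefix-mono (false ∷ b) (suc k) = prefix-mono b k

prefix-suc : ∀ {n} (b : Vec Bool n) k → prefix b (suc k) ≤ suc (prefix b k)
prefix-suc []          k       = z≤n
prefix-suc (true ∷ b)  zero    = s≤s (≤-reflexive (prefix-zero b))
prefix-suc (false ∷ b) zero    = ≤-trans (≤-reflexive (prefix-zero b)) z≤n
prefix-suc (true ∷ b)  (suc k) = s≤s (prefix-suc b k)
prefix-suc (false ∷ b) (suc k) = prefix-suc b k

prefix-false : ∀ n k → prefix (replicate n false) k ≡ 0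
prefix-false zero    k       = refl
prefix-false (suc n) zero    = refl
prefix-false (suc n) (suc k) = prefix-false n k

prefix-injective : ∀ {n} (b b′ : Vec Bool n) → (∀ k → k ≤ n → prefix b k ≡ prefix b′ k) → b ≡ b′
prefix-injective []      []        _  = refl
prefix-injective (true ∷ b)  (true ∷ b′)  eq = cong (true ∷_) (prefix-injective b b′ λ k k≤n →
  suc-injective (eq (suc k) (s≤s k≤n)))
prefix-injective (false ∷ b) (false ∷ b′) eq = cong (false ∷_) (prefix-injective b b′ λ k k≤n →
  eq (suc k) (s≤s k≤n))
prefix-injective (true ∷ b)  (false ∷ b′) eq = contradiction (trans (eq 1 (s≤s z≤n)) (prefix-zero b′)) λ ()
prefix-injective (false ∷ b) (true ∷ b′)  eq = contradiction (trans (sym (eq 1 (s≤s z≤n))) (prefix-zero b)) λ ()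

dominates⇒prefix : ∀ {d n} {b c : Vec Bool n} → Dominates d b c → ∀ k → prefix c k ≤ d + prefix b k
dominates⇒prefix []       k       = z≤n
dominates⇒prefix (same m) zero    = z≤n
dominates⇒prefix (gain m) zero    = z≤n
dominates⇒prefix (loss m) zero    = z≤n
dominates⇒prefix {d} (same {x = true} m)  (suc k) =
  ≤-trans (s≤s (dominates⇒prefix m k)) (≤-reflexive (sym (+-suc d _)))
dominates⇒prefix (same {x = false} m) (suc k) = dominates⇒prefix m k
dominates⇒prefix {d} (gain m) (suc k) =
  ≤-trans (dominates⇒prefix m k) (≤-reflexive (sym (+-suc d _)))
dominates⇒prefix (loss m) (suc k) = s≤s (dominates⇒prefix m k)

prefix⇒dominates : ∀ {d n} (b c : Vec Bool n) → (∀ k → k ≤ n → prefix c k ≤ d + prefix b k) → Dominates d b c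
prefix⇒dominates []          []          _  = []
prefix⇒dominates {d} (true ∷ b)  (true ∷ c)  le = same (prefix⇒dominates b c λ k k≤n →
  s≤s⁻¹ (≤-trans (le (suc k) (s≤s k≤n)) (≤-reflexive (+-suc d _))))
prefix⇒dominates (false ∷ b) (false ∷ c) le = same (prefix⇒dominates b c λ k k≤n → le (suc k) (s≤s k≤n))
prefix⇒dominates {d} (true ∷ b) (false ∷ c) le = gain (prefix⇒dominates b c λ k k≤n →
  ≤-trans (le (suc k) (s≤s k≤n)) (≤-reflexive (+-suc d _)))
prefix⇒dominates {suc d} (false ∷ b) (true ∷ c) le = loss (prefix⇒dominates b c λ k k≤n → s≤s⁻¹ (le (suc k) (s≤s k≤n)))
prefix⇒dominates {zero}  (false ∷ b) (true ∷ c) le =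
  contradiction (≤-trans (le 1 (s≤s z≤n)) (≤-reflexive (prefix-zero b))) λ ()

-- Level sets

-- g k i is entry i on the diagonal of length k.
record Interlaced (n : ℕ) (g : ℕ → ℕ → ℕ) : Set where
  field
    grow   : ∀ {k i} → i < k → k < n → g k i ≤ g (suc k) i
    shrink : ∀ {k i} → i < k → k < n → g (suc k) (suc i) ≤ g k i

open Interlaced

Support : ∀ {n} → (ℕ → ℕ → ℕ) → Vec Bool n → Set
Support {n} g b = ∀ {k i} → i < k → k ≤ n → 0 < g k i ⇔ i < prefix b k

module _ {n g} (inter : Interlaced n g) where

  private
    Boundary : ℕ → ℕ → Set
    Boundary k r = ∀ {i} → i < k → 0 < g k i ⇔ i < r

    module _ {k r} (k<n : k < n) (r≤k : r ≤ k) (boundary : Boundary k r) where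

      below-next : ∀ {i} → i < suc k → 0 < g (suc k) i → i ≤ r
      below-next {zero}  _         _   = z≤n
      below-next {suc i} (s≤s i<k) pos = to (boundary i<k) (<-≤-trans pos (shrink inter i<k k<n))

      above-next : ∀ {i} → i < r → 0 < g (suc k) i
      above-next i<r = <-≤-trans (from (boundary i<k) i<r) (grow inter i<k k<n)
        where i<k = <-≤-trans i<r r≤k

      -- Interlacing makes the entries before position `r` of the longer diagonal positive and those
      -- beyond it 0. Only entry `r` is undecided, and its sign is the next bit of the boundary.
      next : Boundary (suc k) (suc r) ⊎ Boundary (suc k) r
      next with 0 <? g (suc k) r
      ... | yes pos = inj₁ λ i<1+k → mk⇔ (s≤s ∘ below-next i<1+k) (reach ∘ m<1+n⇒m<n∨m≡n)
        where
        reach : ∀ {i} → i < r ⊎ i ≡ r → 0 < g (suc k) i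
        reach (inj₁ i<r)  = above-next i<r
        reach (inj₂ refl) = pos
      ... | no ¬pos = inj₂ λ i<1+k → mk⇔
        (λ pos → ≤∧≢⇒< (below-next i<1+k pos) λ { refl → ¬pos pos }) above-next

    trace : ∀ m {k r} → k + m ≡ n → r ≤ k → Boundary k r →
      ∃ λ (b : Vec Bool m) → ∀ q → q ≤ m → Boundary (k + q) (r + prefix b q)
    trace zero {k} {r} _ _ boundary = [] , λ where
      zero _ → subst₂ Boundary (sym (+-identityʳ k)) (sym (+-identityʳ r)) boundary
    trace (suc m) {k} {r} refl r≤k boundary
      with next (≤-trans (s≤s (m≤m+n k m)) (≤-reflexive (sym (+-suc k m)))) r≤k boundary
    ... | inj₁ boundary′ with b , rest ← trace m (sym (+-suc k m)) (s≤s r≤k) boundary′ = true ∷ b , λ where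
      zero    _         → subst₂ Boundary (sym (+-identityʳ k)) (sym (+-identityʳ r)) boundary
      (suc q) (s≤s q≤m) → subst₂ Boundary (sym (+-suc k q)) (sym (+-suc r _)) (rest q q≤m)
    ... | inj₂ boundary′ with b , rest ← trace m (sym (+-suc k m)) (m≤n⇒m≤1+n r≤k) boundary′ = false ∷ b , λ where
      zero    _         → subst₂ Boundary (sym (+-identityʳ k)) (sym (+-identityʳ r)) boundary
      (suc q) (s≤s q≤m) → subst₂ Boundary (sym (+-suc k q)) refl (rest q q≤m)

  support : ∃ λ (b : Vec Bool n) → Support g b
  support with b , boundary ← trace n refl z≤n (λ ()) = b , λ i<k k≤n → boundary _ k≤n i<k

-- Truncated `pred` removes one layer at a time, so the vector at position m, counted from 0, bounds
-- the set where `g` exceeds m.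
Levels : ∀ {n c} → Vec (Vec Bool n) c → (ℕ → ℕ → ℕ) → Set
Levels {n} []   g = ∀ {k i} → i < k → k ≤ n → g k i ≡ 0
Levels (b ∷ bs) g = Support g b × Levels bs (λ k i → pred (g k i))

interlaced-pred : ∀ {n g} → Interlaced n g → Interlaced n (λ k i → pred (g k i))
interlaced-pred inter .grow   i<k k<n = pred-mono-≤ (grow inter i<k k<n)
interlaced-pred inter .shrink i<k k<n = pred-mono-≤ (shrink inter i<k k<n)

levels-support : ∀ {n c g} (bs : Vec (Vec Bool n) c) → Levels bs g → Support g (strongest bs)
levels-support {n} [] g≡0 {k} {i} i<k k≤n = mk⇔
  (λ 0<g → contradiction (≤-trans 0<g (≤-reflexive (g≡0 i<k k≤n))) λ ())
  (λ i<0 → contradiction (≤-trans i<0 (≤-reflexive (prefix-false n k))) λ ())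
levels-support (_ ∷ _) (supp , _) = supp

<-subset⇒≤ : ∀ {m n k} → m ≤ k → (∀ {i} → i < k → i < m → i < n) → m ≤ n
<-subset⇒≤ {zero}  _   _   = z≤n
<-subset⇒≤ {suc m} m<k sub = sub m<k ≤-refl

support-dominates : ∀ {n g g′} (b b′ : Vec Bool n) → Support g b → Support g′ b′ →
  (∀ {k i} → i < k → k ≤ n → 0 < g′ k i → 0 < g k i) → ∀ k → k ≤ n → prefix b′ k ≤ prefix b k
support-dominates b b′ supp supp′ imp k k≤n = <-subset⇒≤ (prefix-≤ b′ k) λ i<k →
  to (supp i<k k≤n) ∘ imp i<k k≤n ∘ from (supp′ i<k k≤n)

levels : ∀ {n} c {g} → Interlaced n g → (∀ {k i} → i < k → k ≤ n → g k i ≤ c) →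
  ∃ λ (bs : Vec (Vec Bool n) c) → Descending bs × Levels bs g
levels zero    inter bound = [] , [] , λ i<k k≤n → n≤0⇒n≡0 (bound i<k k≤n)
levels (suc c) inter bound
  with b , supp ← support inter
  with bs , desc , lev ← levels c (interlaced-pred inter) (λ i<k k≤n → pred-mono-≤ (bound i<k k≤n))
  = b ∷ bs
  , prefix⇒dominates b (strongest bs)
      (support-dominates b (strongest bs) supp (levels-support bs lev) (λ _ _ 0<p → ≤-trans 0<p pred[n]≤n))
    ∷ desc
  , supp , lev

-- The count stops at the first level that misses the cell. For a descending chain the levels are
-- nested, so nothing is lost, and applying `pred` amounts to dropping the first vector.
count : ∀ {n c} → Vec (Vec Bool n) c → ℕ → ℕ → ℕ
count []       k i = 0
count (b ∷ bs) k i with i <? prefix b k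
... | yes _ = suc (count bs k i)
... | no  _ = 0

count-≤ : ∀ {n c} (bs : Vec (Vec Bool n) c) k i → count bs k i ≤ c
count-≤ []       k i = z≤n
count-≤ (b ∷ bs) k i with i <? prefix b k
... | yes _ = s≤s (count-≤ bs k i)
... | no  _ = z≤n

levels-cong : ∀ {n c g g′} (bs : Vec (Vec Bool n) c) → (∀ {k i} → i < k → k ≤ n → g k i ≡ g′ k i) →
  Levels bs g → Levels bs g′
levels-cong []       eq g≡0          i<k k≤n = trans (sym (eq i<k k≤n)) (g≡0 i<k k≤n)
levels-cong (b ∷ bs) eq (supp , lev) =
  (λ i<k k≤n → mk⇔ (λ 0<g → to (supp i<k k≤n) (≤-trans 0<g (≤-reflexive (sym (eq i<k k≤n)))))
                   (λ i<p → ≤-trans (from (supp i<k k≤n) i<p) (≤-reflexive (eq i<k k≤n))))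
  , levels-cong bs (λ i<k k≤n → cong pred (eq i<k k≤n)) lev

count-levels : ∀ {n c} {bs : Vec (Vec Bool n) c} → Descending bs → Levels bs (count bs)
count-levels [] _ _ = refl
count-levels {n} (_∷_ {b = b} {bs = bs} dom desc) = positive , levels-cong bs pred-count lev
  where
  lev : Levels bs (count bs)
  lev = count-levels desc

  positive : Support (count (b ∷ bs)) b
  positive {k} {i} _ _ with i <? prefix b k
  ... | yes i<p = mk⇔ (λ _ → i<p) (λ _ → s≤s z≤n)
  ... | no  i≮p = mk⇔ (λ ()) (λ i<p → contradiction i<p i≮p)

  pred-count : ∀ {k i} → i < k → k ≤ n → count bs k i ≡ pred (count (b ∷ bs) k i)
  pred-count {k} {i} i<k k≤n with i <? prefix b k
  ... | yes _   = refl
  ... | no  i≮p = n≤0⇒n≡0 (≮⇒≥ λ 0<g → i≮p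
    (<-≤-trans (to (levels-support bs lev i<k k≤n) 0<g) (dominates⇒prefix dom k)))

pred-reflects-≤ : ∀ {m n} → (0 < m → 0 < n) → pred m ≤ pred n → m ≤ n
pred-reflects-≤ {zero}          _   _  = z≤n
pred-reflects-≤ {suc m} {zero}  pos _  = contradiction (pos (s≤s z≤n)) λ ()
pred-reflects-≤ {suc m} {suc n} _   le = s≤s le

module _ {n : ℕ} {k i k′ i′ : ℕ} (i<k : i < k) (k≤n : k ≤ n) (i′<k′ : i′ < k′) (k′≤n : k′ ≤ n) where

  -- Values are compared level by level, for two functions and two cells at once: one function at
  -- neighbouring cells gives interlacing, two functions at one cell give uniqueness.
  levels-≤ : ∀ {c g g′} (bs : Vec (Vec Bool n) c) → Levels bs g → Levels bs g′ →
    (∀ (b : Vec Bool n) → i < prefix b k → i′ < prefix b k′) → g k i ≤ g′ k′ i′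
  levels-≤ []       g≡0          _              imp = ≤-trans (≤-reflexive (g≡0 i<k k≤n)) z≤n
  levels-≤ (b ∷ bs) (supp , lev) (supp′ , lev′) imp = pred-reflects-≤
    (from (supp′ i′<k′ k′≤n) ∘ imp b ∘ to (supp i<k k≤n)) (levels-≤ bs lev lev′ imp)

levels-interlaced : ∀ {n c g} (bs : Vec (Vec Bool n) c) → Levels bs g → Interlaced n g
levels-interlaced bs lev .grow {k} i<k k<n =
  levels-≤ i<k (<⇒≤ k<n) (m≤n⇒m≤1+n i<k) k<n bs lev lev λ b i<p → <-≤-trans i<p (prefix-mono b k)
levels-interlaced bs lev .shrink {k} i<k k<n =
  levels-≤ (s≤s i<k) k<n i<k (<⇒≤ k<n) bs lev lev λ b i<p → s≤s⁻¹ (<-≤-trans i<p (prefix-suc b k))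

levels-functional : ∀ {n c g g′} (bs : Vec (Vec Bool n) c) → Levels bs g → Levels bs g′ →
  ∀ {k i} → i < k → k ≤ n → g k i ≡ g′ k i
levels-functional bs lev lev′ i<k k≤n = ≤-antisym
  (levels-≤ i<k k≤n i<k k≤n bs lev lev′ (λ _ p → p)) (levels-≤ i<k k≤n i<k k≤n bs lev′ lev (λ _ p → p))

levels-injective : ∀ {n c g} (bs bs′ : Vec (Vec Bool n) c) → Levels bs g → Levels bs′ g → bs ≡ bs′
levels-injective []       []         _            _              = refl
levels-injective (b ∷ bs) (b′ ∷ bs′) (supp , lev) (supp′ , lev′) = cong₂ _∷_
  (prefix-injective b b′ λ k k≤n → ≤-antisym
    (support-dominates b′ b supp′ supp (λ _ _ p → p) k k≤n) (support-dominates b b′ supp supp′ (λ _ _ p → p) k k≤n))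
  (levels-injective bs bs′ lev lev′)

-- Last-passage values

-- Removes the diagonal entry of a column: the column to its left is one shorter, so that entry is
-- nobody's right neighbour within the triangle.
dropLast : ∀ {m} → Vec ℕ (suc m) → Vec ℕ m
dropLast {zero}  _        = []
dropLast {suc m} (x ∷ xs) = x ∷ dropLast xs

-- Last-passage values of a column with weights w, where v is the column to its right and z the value above.
run : ∀ {m} → ℕ → Vec ℕ m → Vec ℕ m → Vec ℕ m
run z []       []       = []
run z (v ∷ vs) (w ∷ ws) = w + (z ⊔ v) ∷ run (w + (z ⊔ v)) vs ws

unrun : ∀ {m} → ℕ → Vec ℕ m → Vec ℕ m → Vec ℕ m
unrun z []       []       = []
unrun z (v ∷ vs) (a ∷ as) = a ∸ (z ⊔ v) ∷ unrun a vs as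

Increasing : ∀ {m} → ℕ → Vec ℕ m → Vec ℕ m → Set
Increasing z []       []       = ⊤
Increasing z (v ∷ vs) (a ∷ as) = z ⊔ v ≤ a × Increasing a vs as

unrun-run : ∀ {m} z (v w : Vec ℕ m) → unrun z v (run z v w) ≡ w
unrun-run z []       []       = refl
unrun-run z (v ∷ vs) (w ∷ ws) = cong₂ _∷_ (m+n∸n≡m w (z ⊔ v)) (unrun-run _ vs ws)

run-unrun : ∀ {m} z (v a : Vec ℕ m) → Increasing z v a → run z v (unrun z v a) ≡ a
run-unrun z []       []       _          = refl
run-unrun z (v ∷ vs) (a ∷ as) (le , inc) rewrite m∸n+n≡m le = cong (a ∷_) (run-unrun a vs as inc)

run-increasing : ∀ {m} z (v w : Vec ℕ m) → Increasing z v (run z v w)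
run-increasing z []       []       = tt
run-increasing z (v ∷ vs) (w ∷ ws) = m≤n+m (z ⊔ v) w , run-increasing _ vs ws

-- Only the diagonal cell is tested. There `a` is the best weight of a path arriving from the top
-- right corner and `z ⊔ v` the same without the cell itself, so the sum is the weight of that path
-- continued by its reflection, with the diagonal entry counted once.
Ends : ∀ {m} → ℕ → ℕ → Vec ℕ (suc m) → Vec ℕ (suc m) → Set
Ends {zero}  c z (v ∷ _)  (a ∷ _)  = a + (z ⊔ v) ≤ c
Ends {suc m} c z (_ ∷ vs) (a ∷ as) = Ends c a vs as

-- A path entering the remaining triangle in a given row has collected `v` before, gathers at most
-- `h` inside, and by reflection collects `v` again after leaving.
Fits : ∀ {m} → ℕ → Vec ℕ m → Vec ℕ m → Set
Fits c []       []       = ⊤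
Fits c (v ∷ vs) (h ∷ hs) = v + (v + h) ≤ c × Fits c vs hs

accumulate : ∀ {n} → Vec ℕ n → Triangle n → Triangle n
accumulate v ε       = ε
accumulate v (T ▹ w) = accumulate (dropLast (run 0 v w)) T ▹ run 0 v w

unaccumulate : ∀ {n} → Vec ℕ n → Triangle n → Triangle n
unaccumulate v ε       = ε
unaccumulate v (A ▹ a) = unaccumulate (dropLast a) A ▹ unrun 0 v a

Monotone : ∀ {n} → Vec ℕ n → Triangle n → Set
Monotone v ε       = ⊤
Monotone v (A ▹ a) = Increasing 0 v a × Monotone (dropLast a) A

Bounded : ∀ {n} → ℕ → Vec ℕ n → Triangle n → Set
Bounded c v ε       = ⊤
Bounded c v (A ▹ a) = Ends c 0 v a × Bounded c (dropLast a) A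

unaccumulate-accumulate : ∀ {n} (v : Vec ℕ n) T → unaccumulate v (accumulate v T) ≡ T
unaccumulate-accumulate v ε       = refl
unaccumulate-accumulate v (T ▹ w) = cong₂ _▹_ (unaccumulate-accumulate _ T) (unrun-run 0 v w)

accumulate-unaccumulate : ∀ {n} (v : Vec ℕ n) A → Monotone v A → accumulate v (unaccumulate v A) ≡ A
accumulate-unaccumulate v ε       _           = refl
accumulate-unaccumulate v (A ▹ a) (inc , mon)
  rewrite run-unrun 0 v a inc = cong (_▹ a) (accumulate-unaccumulate _ A mon)

accumulate-monotone : ∀ {n} (v : Vec ℕ n) T → Monotone v (accumulate v T)
accumulate-monotone v ε       = tt
accumulate-monotone v (T ▹ w) = run-increasing 0 v w , accumulate-monotone _ T

module _ {c : ℕ} where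

  twice-⊔ : ∀ x y t → (x + (x + t) ≤ c × y + (y + t) ≤ c) ⇔ (x ⊔ y) + ((x ⊔ y) + t) ≤ c
  twice-⊔ x y t = mk⇔ (λ (p , q) → either p q) (λ r →
    ≤-trans (twice-mono (m≤m⊔n x y)) r , ≤-trans (twice-mono (m≤n⊔m x y)) r)
    where
    twice-mono : ∀ {a b} → a ≤ b → a + (a + t) ≤ b + (b + t)
    twice-mono a≤b = +-mono-≤ a≤b (+-monoˡ-≤ t a≤b)
    either : x + (x + t) ≤ c → y + (y + t) ≤ c → (x ⊔ y) + ((x ⊔ y) + t) ≤ c
    either p q with ⊔-sel x y
    ... | inj₁ eq rewrite eq = p
    ... | inj₂ eq rewrite eq = q

  ⊔-bound : ∀ k x y → (k + x ≤ c × k + y ≤ c) ⇔ k + (x ⊔ y) ≤ c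
  ⊔-bound k x y = mk⇔ (λ (p , q) → ≤-trans (≤-reflexive (+-distribˡ-⊔ k x y)) (⊔-lub p q))
    (λ r → ≤-trans (+-monoʳ-≤ k (m≤m⊔n x y)) r , ≤-trans (+-monoʳ-≤ k (m≤n⊔m x y)) r)

  shift-weight : ∀ m w t → m + (m + (w + (w + t))) ≡ (w + m) + ((w + m) + t)
  shift-weight = solve-∀

  -- Transfers one column of weights from the inner heights to the arrival values outside. An
  -- off-diagonal weight counted twice in `extend` becomes part of an arrival value that `Fits`
  -- counts twice, and `z` stands for paths coming down within the column. Doubling and adding
  -- commute with maxima, so the bounds split row by row.
  column-fits : ∀ {m} z (v w : Vec ℕ (suc m)) (h : Vec ℕ m) →
    (z + (z + top (extend h w)) ≤ c × Fits c v (extend h w)) ⇔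
    (Fits c (dropLast (run z v w)) h × Ends c z v (run z v w))
  column-fits z (v ∷ []) (w ∷ []) [] = mk⇔
    (λ (p , q , _) → tt , subst (_≤ c) end≡ (to (twice-⊔ z v w) (p , q)))
    (λ (_ , e) → let (p , q) = from (twice-⊔ z v w) (subst (_≤ c) (sym end≡) e) in p , q , tt)
    where
    m = z ⊔ v
    end≡ : m + (m + w) ≡ w + m + m
    end≡ = trans (+-comm m (m + w)) (cong (_+ m) (+-comm m w))
  column-fits z (v ∷ vs) (w ∷ ws) (h ∷ hs) = mk⇔
    (λ (p , q , fits) →
      let (x , y) = from split (subst (_≤ c) eq (to (twice-⊔ z v _) (p , q)))
          (fits′ , ends) = to ih (y , fits)
      in (x , fits′) , ends)
    (λ ((x , fits′) , ends) →
      let (y , fits) = from ih (fits′ , ends)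
          (p , q) = from (twice-⊔ z v _) (subst (_≤ c) (sym eq) (to split (x , y)))
      in p , q , fits)
    where
    a t : ℕ
    a = w + (z ⊔ v)
    t = top (extend hs ws)
    ih = column-fits a vs ws hs
    split : (a + (a + h) ≤ c × a + (a + t) ≤ c) ⇔ a + (a + (h ⊔ t)) ≤ c
    split = subst₂ (λ x y → (x ≤ c × y ≤ c) ⇔ a + (a + (h ⊔ t)) ≤ c) (+-assoc a a h) (+-assoc a a t)
      (subst (λ x → (a + a + h ≤ c × a + a + t ≤ c) ⇔ x ≤ c) (+-assoc a a (h ⊔ t)) (⊔-bound (a + a) h t))
    eq = shift-weight (z ⊔ v) w (h ⊔ t)

  bounded-fits : ∀ {n} (v : Vec ℕ n) T → Bounded c v (accumulate v T) ⇔ Fits c v (heights T)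
  bounded-fits [] ε = mk⇔ (λ _ → tt) (λ _ → tt)
  bounded-fits v (T ▹ w) = mk⇔
    (λ (ends , bounded) → proj₂ (from column (to ih bounded , ends)))
    -- Nothing arrives above the first row, so `z` is 0 and the extra inequality of `column-fits`
    -- already follows from `Fits`.
    (λ fits → let (fits′ , ends) = to column (top-fits v _ fits , fits) in ends , from ih fits′)
    where
    column = column-fits 0 v w (heights T)
    ih = bounded-fits (dropLast (run 0 v w)) T
    top-fits : ∀ {m} (v h : Vec ℕ m) → Fits c v h → top h ≤ c
    top-fits []       []       _        = z≤n
    top-fits (v ∷ vs) (h ∷ hs) (le , _) = ≤-trans (≤-trans (m≤n+m h v) (m≤n+m (v + h) v)) le

  fits-extend : ∀ {m} (h : Vec ℕ m) w → top (extend h w) ≤ c → Fits c (replicate (suc m) 0) (extend h w)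
  fits-extend []       (w ∷ []) le = le , tt
  fits-extend (h ∷ hs) (w ∷ ws) le = le , fits-extend hs ws (≤-trans (tail≤extend h w hs ws) le)

  -- Heights weakly decrease down a column, so with zero arrival values the bound on the first row
  -- implies all others.
  bounded-top : ∀ {n} (T : Triangle n) → Bounded c (replicate n 0) (accumulate (replicate n 0) T) ⇔ top (heights T) ≤ c
  bounded-top ε       = mk⇔ (λ _ → z≤n) (λ _ → tt)
  bounded-top (T ▹ w) = mk⇔ (λ b → first (to fits b)) (λ le → from fits (fits-extend (heights T) w le))
    where
    fits = bounded-fits (replicate _ 0) (T ▹ w)
    first : ∀ {m} {h : Vec ℕ (suc m)} → Fits c (replicate (suc m) 0) h → top h ≤ c
    first {h = _ ∷ _} (le , _) = le

-- Triangular arrays as functions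

column : ∀ m → (ℕ → ℕ) → Vec ℕ m
column zero    g = []
column (suc m) g = g 0 ∷ column m (g ∘ suc)

column-cong : ∀ m {g g′} → (∀ {s} → s < m → g s ≡ g′ s) → column m g ≡ column m g′
column-cong zero    eq = refl
column-cong (suc m) eq = cong₂ _∷_ (eq (s≤s z≤n)) (column-cong m (eq ∘ s≤s))

column-injective : ∀ m {g g′} → column m g ≡ column m g′ → ∀ {s} → s < m → g s ≡ g′ s
column-injective (suc m) eq {zero}  _         = cong top eq
column-injective (suc m) eq {suc s} (s≤s s<m) = column-injective m (cong (λ { (_ ∷ xs) → xs }) eq) s<m

column-zero : ∀ m {g} → (∀ {s} → s < m → g s ≡ 0) → column m g ≡ replicate m 0
column-zero zero    eq = refl
column-zero (suc m) eq = cong₂ _∷_ (eq (s≤s z≤n)) (column-zero m (eq ∘ s≤s))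

dropLast-column : ∀ m g → dropLast (column (suc m) g) ≡ column m g
dropLast-column zero    g = refl
dropLast-column (suc m) g = cong (g 0 ∷_) (dropLast-column m (g ∘ suc))

nth : ∀ {m} → Vec ℕ m → ℕ → ℕ
nth []       _       = 0
nth (x ∷ _)  zero    = x
nth (_ ∷ xs) (suc s) = nth xs s

column-nth : ∀ {m} (v : Vec ℕ m) → column m (nth v) ≡ v
column-nth []      = refl
column-nth (x ∷ v) = cong (x ∷_) (column-nth v)

before : ℕ → (ℕ → ℕ) → ℕ → ℕ
before z g zero    = z
before z g (suc m) = g m

increasing⁺ : ∀ m z h g → (0 < m → z ≤ g 0) → (∀ {s} → s < m → h s ≤ g s) →
  (∀ {s} → suc s < m → g s ≤ g (suc s)) → Increasing z (column m h) (column m g)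
increasing⁺ zero    z h g p q r = tt
increasing⁺ (suc m) z h g p q r = ⊔-lub (p (s≤s z≤n)) (q (s≤s z≤n)) ,
  increasing⁺ m (g 0) (h ∘ suc) (g ∘ suc) (r ∘ s≤s) (q ∘ s≤s) (r ∘ s≤s)

increasing⁻ : ∀ m z h g → Increasing z (column m h) (column m g) →
  (0 < m → z ≤ g 0) × (∀ {s} → s < m → h s ≤ g s) × (∀ {s} → suc s < m → g s ≤ g (suc s))
increasing⁻ zero    z h g _          = (λ ()) , (λ ()) , (λ ())
increasing⁻ (suc m) z h g (le , inc) =
  let (p , q , r) = increasing⁻ m (g 0) (h ∘ suc) (g ∘ suc) inc in
  (λ _ → ≤-trans (m≤m⊔n z (h 0)) le)
  , (λ { {zero} _ → ≤-trans (m≤n⊔m z (h 0)) le ; {suc s} (s≤s s<m) → q s<m })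
  , (λ { {zero} (s≤s 0<m) → p 0<m ; {suc s} (s≤s s<m) → r s<m })

ends≡ : ∀ c m z h g → Ends c z (column (suc m) h) (column (suc m) g) ≡ (g m + (before z g m ⊔ h m) ≤ c)
ends≡ c zero          z h g = refl
ends≡ c (suc zero)    z h g = refl
ends≡ c (suc (suc m)) z h g = ends≡ c (suc m) (g 0) (h ∘ suc) (g ∘ suc)

triangle : ∀ n → (ℕ → ℕ → ℕ) → Triangle n
triangle zero    f = ε
triangle (suc n) f = triangle n f ▹ column (suc n) (λ s → f s n)

triangle-cong : ∀ n {f f′} → (∀ {s j} → s ≤ j → j < n → f s j ≡ f′ s j) → triangle n f ≡ triangle n f′
triangle-cong zero    eq = refl
triangle-cong (suc n) eq = cong₂ _▹_ (triangle-cong n λ s≤j j<n → eq s≤j (m≤n⇒m≤1+n j<n))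
  (column-cong (suc n) λ s<1+n → eq (s≤s⁻¹ s<1+n) ≤-refl)

triangle-injective : ∀ n {f f′} → triangle n f ≡ triangle n f′ → ∀ {s j} → s ≤ j → j < n → f s j ≡ f′ s j
triangle-injective (suc n) {f} {f′} eq {s} {j} s≤j j<1+n with m<1+n⇒m<n∨m≡n j<1+n
... | inj₁ j<n  = triangle-injective n (cong (λ { (T ▹ _) → T }) eq) s≤j j<n
... | inj₂ refl = column-injective (suc n) {λ s → f s n} {λ s → f′ s n} (cong (λ { (_ ▹ w) → w }) eq) (s≤s s≤j)

cell : ∀ {n} → Triangle n → ℕ → ℕ → ℕ
cell ε _ _ = 0
cell {suc n} (T ▹ w) s j with j ≟ n
... | yes _ = nth w s
... | no  _ = cell T s j

cell-outside : ∀ {n} (T : Triangle n) s {j} → n ≤ j → cell T s j ≡ 0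
cell-outside ε s _ = refl
cell-outside {suc n} (T ▹ w) s {j} n<j with j ≟ n
... | yes refl = contradiction n<j 1+n≰n
... | no  _    = cell-outside T s (<⇒≤ n<j)

triangle-cell : ∀ {n} (T : Triangle n) → triangle n (cell T) ≡ T
triangle-cell ε = refl
triangle-cell {suc n} (T ▹ w) = cong₂ _▹_
  (trans (triangle-cong n (λ _ → inner)) (triangle-cell T))
  (trans (column-cong (suc n) (λ {s} _ → last s)) (column-nth w))
  where
  inner : ∀ {s j} → j < n → cell (T ▹ w) s j ≡ cell T s j
  inner {s} {j} j<n with j ≟ n
  ... | yes refl = contradiction j<n (n≮n n)
  ... | no  _    = refl
  last : ∀ s → cell (T ▹ w) s n ≡ nth w s
  last s with n ≟ n
  ... | yes _  = refl
  ... | no n≢n = contradiction refl n≢n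

-- The entrywise form of `Monotone` and `Bounded`. At `j` equal to the last column, `left` and
-- `diagonal` refer to one more column on the right; it holds the arrival values from outside, which
-- `weights` requires to be 0 and the default of `cell` makes 0 in `unweights`.
record Staircase (n c : ℕ) (f : ℕ → ℕ → ℕ) : Set where
  field
    up       : ∀ {s j} → suc s ≤ j → j < n → f s j ≤ f (suc s) j
    left     : ∀ {s j} → s ≤ j → j < n → f s (suc j) ≤ f s j
    diagonal : ∀ {j} → j < n → f j j + (before 0 (λ s → f s j) j ⊔ f j (suc j)) ≤ c

open Staircase

module _ {c : ℕ} {f : ℕ → ℕ → ℕ} where

  staircase⁺ : ∀ n → Monotone (column n (λ s → f s n)) (triangle n f) →
    Bounded c (column n (λ s → f s n)) (triangle n f) → Staircase n c f
  staircase⁺ zero    _           _             = record { up = λ _ () ; left = λ _ () ; diagonal = λ () }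
  staircase⁺ (suc n) (inc , mon) (ends , bnd)
    with _ , q , r ← increasing⁻ (suc n) 0 (λ s → f s (suc n)) (λ s → f s n) inc
    rewrite dropLast-column n (λ s → f s n) = record { up = up′ ; left = left′ ; diagonal = diagonal′ }
    where
    rest = staircase⁺ n mon bnd
    up′ : ∀ {s j} → suc s ≤ j → j < suc n → f s j ≤ f (suc s) j
    up′ s<j j<1+n with m<1+n⇒m<n∨m≡n j<1+n
    ... | inj₁ j<n  = up rest s<j j<n
    ... | inj₂ refl = r (s≤s s<j)
    left′ : ∀ {s j} → s ≤ j → j < suc n → f s (suc j) ≤ f s j
    left′ s≤j j<1+n with m<1+n⇒m<n∨m≡n j<1+n
    ... | inj₁ j<n  = left rest s≤j j<n
    ... | inj₂ refl = q (s≤s s≤j)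
    diagonal′ : ∀ {j} → j < suc n → f j j + (before 0 (λ s → f s j) j ⊔ f j (suc j)) ≤ c
    diagonal′ j<1+n with m<1+n⇒m<n∨m≡n j<1+n
    ... | inj₁ j<n  = diagonal rest j<n
    ... | inj₂ refl = subst (λ A → A) (ends≡ c n 0 (λ s → f s (suc n)) (λ s → f s n)) ends

  staircase⁻ : ∀ n → Staircase n c f →
    Monotone (column n (λ s → f s n)) (triangle n f) × Bounded c (column n (λ s → f s n)) (triangle n f)
  staircase⁻ zero    _  = tt , tt
  staircase⁻ (suc n) st rewrite dropLast-column n (λ s → f s n) =
    let (mon , bnd) = staircase⁻ n inner in
    (increasing⁺ (suc n) 0 (λ s → f s (suc n)) (λ s → f s n) (λ _ → z≤n)
       (λ s<1+n → left st (s≤s⁻¹ s<1+n) ≤-refl) (λ s<n → up st (s≤s⁻¹ s<n) ≤-refl) , mon)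
    , (subst (λ A → A) (sym (ends≡ c n 0 (λ s → f s (suc n)) (λ s → f s n))) (diagonal st ≤-refl) , bnd)
    where
    inner : Staircase n c f
    inner .up       s<j j<n = up st s<j (m≤n⇒m≤1+n j<n)
    inner .left     s≤j j<n = left st s≤j (m≤n⇒m≤1+n j<n)
    inner .diagonal j<n     = diagonal st (m≤n⇒m≤1+n j<n)

Weights : ∀ n → (ℕ → ℕ → ℕ) → Triangle n → Set
Weights n f T = triangle n f ≡ accumulate (replicate n 0) T

weights : ∀ {n c f} → (∀ {s} → s < n → f s n ≡ 0) → Staircase n c f →
  ∃ λ T → top (heights T) ≤ c × Weights n f T
weights {n} {c} {f} edge st
  with mon , bnd ← staircase⁻ n st
  rewrite column-zero n edge
  = T , to (bounded-top T) (subst (Bounded c (replicate n 0)) acc bnd) , acc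
  where
  T = unaccumulate (replicate n 0) (triangle n f)
  acc = sym (accumulate-unaccumulate (replicate n 0) (triangle n f) mon)

unweights : ∀ {n c} (T : Triangle n) → top (heights T) ≤ c →
  ∃ λ f → Staircase n c f × Weights n f T
unweights {n} {c} T le = f , staircase⁺ n
    (subst₂ Monotone (sym edge) (sym f≡A) (accumulate-monotone (replicate n 0) T))
    (subst₂ (Bounded c) (sym edge) (sym f≡A) (from (bounded-top T) le)) , f≡A
  where
  A = accumulate (replicate n 0) T
  f = cell A
  f≡A : triangle n f ≡ A
  f≡A = triangle-cell A
  edge : column n (λ s → f s n) ≡ replicate n 0
  edge = column-zero n (λ {s} _ → cell-outside A s ≤-refl)

weights-functional : ∀ {n f T T′} → Weights n f T → Weights n f T′ → T ≡ T′
weights-functional {n} {T = T} {T′} eq eq′ =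
  trans (sym (unaccumulate-accumulate (replicate n 0) T))
    (trans (cong (unaccumulate (replicate n 0)) (trans (sym eq) eq′))
      (unaccumulate-accumulate (replicate n 0) T′))

-- Plane partitions

at : ∀ {m k} → Vec (Vec ℕ k) m → ℕ → ℕ → ℕ
at []       _       _ = 0
at (r ∷ _)  zero    j = nth r j
at (_ ∷ rs) (suc i) j = at rs i j

nth-toℕ : ∀ {k} (r : Vec ℕ k) j → nth r (toℕ j) ≡ lookup r j
nth-toℕ (x ∷ r) Fin.zero    = refl
nth-toℕ (x ∷ r) (Fin.suc j) = nth-toℕ r j

at-toℕ : ∀ {m k} (π : Vec (Vec ℕ k) m) i j → at π (toℕ i) (toℕ j) ≡ lookup (lookup π i) j
at-toℕ (r ∷ _)  Fin.zero    j = nth-toℕ r j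
at-toℕ (_ ∷ rs) (Fin.suc i) j = at-toℕ rs i j

at-outside : ∀ {m k} (π : Vec (Vec ℕ k) m) {i} j → m ≤ i → at π i j ≡ 0
at-outside []       j _         = refl
at-outside (_ ∷ rs) j (s≤s m≤i) = at-outside rs j m≤i

array : ∀ n → (ℕ → ℕ → ℕ) → Array n
array n f = tabulate λ i → tabulate λ j → f (toℕ i) (toℕ j)

entry-array : ∀ n f i j → entry (array n f) i j ≡ f (toℕ i) (toℕ j)
entry-array n f i j =
  trans (cong (λ r → lookup r j) (lookup∘tabulate _ i)) (lookup∘tabulate _ j)

module _ {n : ℕ} where

  entry-at : ∀ (π : Array n) {i j} (i<n : i < n) (j<n : j < n) → entry π (fromℕ< i<n) (fromℕ< j<n) ≡ at π i j
  entry-at π i<n j<n = trans (sym (at-toℕ π _ _)) (cong₂ (at π) (toℕ-fromℕ< i<n) (toℕ-fromℕ< j<n))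

  at-array : ∀ f {i j} → i < n → j < n → at (array n f) i j ≡ f i j
  at-array f i<n j<n = trans (sym (entry-at (array n f) i<n j<n))
    (trans (entry-array n f _ _) (cong₂ f (toℕ-fromℕ< i<n) (toℕ-fromℕ< j<n)))

  at-injective : ∀ {π π′ : Array n} → (∀ {i j} → i < n → j < n → at π i j ≡ at π′ i j) → π ≡ π′
  at-injective {π} {π′} eq = lookup-injective′ λ i → lookup-injective′ λ j →
    trans (sym (at-toℕ π i j)) (trans (eq (toℕ<n i) (toℕ<n j)) (at-toℕ π′ i j))
    where
    lookup-injective′ : ∀ {A : Set} {m} {xs ys : Vec A m} → (∀ i → lookup xs i ≡ lookup ys i) → xs ≡ ys
    lookup-injective′ {xs = xs} {ys} eq =
      trans (sym (tabulate∘lookup xs)) (trans (tabulate-cong eq) (tabulate∘lookup ys))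

record PlanePartition (n c : ℕ) (f : ℕ → ℕ → ℕ) : Set where
  field
    bounded : ∀ {i j} → i < n → j < n → f i j ≤ c
    row     : ∀ {i j} → suc i < n → j < n → f (suc i) j ≤ f i j
    col     : ∀ {i j} → i < n → suc j < n → f i (suc j) ≤ f i j

open PlanePartition

steps⇒antitone : ∀ {n} {g : ℕ → ℕ} → (∀ {i} → suc i < n → g (suc i) ≤ g i) →
  ∀ {i i′} → i ≤ i′ → i′ < n → g i′ ≤ g i
steps⇒antitone {n} {g} step {i} i≤i′ = go (≤⇒≤′ i≤i′)
  where
  go : ∀ {i′} → i ≤′ i′ → i′ < n → g i′ ≤ g i
  go ≤′-refl        _    = ≤-refl
  go (≤′-step i≤i′) i′<n = ≤-trans (step i′<n) (go i≤i′ (<⇒≤ i′<n))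

planePartition⁻ : ∀ {n c} (π : Array n) → IsPlanePartition n c π → PlanePartition n c (at π)
planePartition⁻ {n} {c} π (bnd , rows , cols) = record
  { bounded = λ i<n j<n → subst (_≤ c) (entry-at π i<n j<n) (bnd _ _)
  ; row = λ 1+i<n j<n → subst₂ _≤_ (entry-at π 1+i<n j<n) (entry-at π (<⇒≤ 1+i<n) j<n)
      (rows _ _ _ (ordered (<⇒≤ 1+i<n) 1+i<n))
  ; col = λ i<n 1+j<n → subst₂ _≤_ (entry-at π i<n 1+j<n) (entry-at π i<n (<⇒≤ 1+j<n))
      (cols _ _ _ (ordered (<⇒≤ 1+j<n) 1+j<n))
  }
  where
  ordered : ∀ {i} (i<n : i < n) (1+i<n : suc i < n) → toℕ (fromℕ< i<n) ≤ toℕ (fromℕ< 1+i<n)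
  ordered {i} i<n 1+i<n = subst₂ _≤_ (sym (toℕ-fromℕ< i<n)) (sym (toℕ-fromℕ< 1+i<n)) (n≤1+n i)

planePartition⁺ : ∀ {n c f} → PlanePartition n c f → IsPlanePartition n c (array n f)
planePartition⁺ {n} {c} {f} pp =
  (λ i j → subst (_≤ c) (sym (entry-array n f i j)) (bounded pp (toℕ<n i) (toℕ<n j)))
  , (λ i i′ j i≤i′ → subst₂ _≤_ (sym (entry-array n f i′ j)) (sym (entry-array n f i j))
      (steps⇒antitone {g = λ i → f i (toℕ j)} (λ 1+i<n → row pp 1+i<n (toℕ<n j)) i≤i′ (toℕ<n i′)))
  , (λ i j j′ j≤j′ → subst₂ _≤_ (sym (entry-array n f i j′)) (sym (entry-array n f i j))
      (steps⇒antitone {g = f (toℕ i)} (col pp (toℕ<n i)) j≤j′ (toℕ<n j′)))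

-- Symmetric plane partitions through their diagonals

diagonals : ∀ {n} → Array n → ℕ → ℕ → ℕ
diagonals {n} σ k i = at σ i (i + (n ∸ k))

module _ {n : ℕ} where

  i+[n∸k]<n : ∀ {k i} → i < k → k ≤ n → i + (n ∸ k) < n
  i+[n∸k]<n {k} {i} i<k k≤n = <-≤-trans (+-monoˡ-< (n ∸ k) i<k) (≤-reflexive (m+[n∸m]≡n k≤n))

  n∸k≡suc : ∀ {k} → k < n → n ∸ k ≡ suc (n ∸ suc k)
  n∸k≡suc {k} k<n = +-∸-assoc 1 k<n

module _ {n c : ℕ} where

  diagonals-interlaced : ∀ (σ : Array n) → PlanePartition n c (at σ) → Interlaced n (diagonals σ)
  diagonals-interlaced σ pp .grow {k} {i} i<k k<n rewrite n∸k≡suc k<n | +-suc i (n ∸ suc k) =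
    col pp (<-trans i<k k<n) (subst (_< n) (trans (cong (i +_) (n∸k≡suc k<n)) (+-suc i _)) (i+[n∸k]<n i<k (<⇒≤ k<n)))
  diagonals-interlaced σ pp .shrink {k} {i} i<k k<n rewrite n∸k≡suc k<n | +-suc i (n ∸ suc k) =
    row pp (≤-<-trans i<k k<n) (i+[n∸k]<n (s≤s i<k) k<n)

  symmetric⇒levels : ∀ (σ : Array n) → IsPlanePartition n c σ →
    ∃ λ (bs : Vec (Vec Bool n) c) → Descending bs × Levels bs (diagonals σ)
  symmetric⇒levels σ pp = levels c (diagonals-interlaced σ pp′)
    (λ i<k k≤n → bounded pp′ (<-≤-trans i<k k≤n) (i+[n∸k]<n i<k k≤n))
    where pp′ = planePartition⁻ σ pp

  module _ (bs : Vec (Vec Bool n) c) (desc : Descending bs) where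

    private
      g : ℕ → ℕ → ℕ
      g = count bs

      inter : Interlaced n g
      inter = levels-interlaced bs (count-levels desc)

      -- Cell (i, j), or its reflection, is entry `i ⊓ j` on the diagonal of length n - |i - j|, so
      -- both halves are read from the same level sets.
      f : ℕ → ℕ → ℕ
      f i j = g (n ∸ ∣ i - j ∣) (i ⊓ j)

      f-symmetric : ∀ i j → f i j ≡ f j i
      f-symmetric i j = cong₂ (λ d → g (n ∸ d)) (∣-∣-comm i j) (⊓-comm i j)

      f-above : ∀ i d → f i (i + d) ≡ g (n ∸ d) i
      f-above i d = cong₂ (λ d → g (n ∸ d)) (∣m-m+n∣≡n i d) (m≤n⇒m⊓n≡m (m≤m+n i d))

      f-below : ∀ j d → f (j + d) j ≡ g (n ∸ d) j
      f-below j d = trans (f-symmetric (j + d) j) (f-above j d)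

      n∸d>i : ∀ {i d} → i + d < n → i < n ∸ d
      n∸d>i {i} {d} lt = m+n≤o⇒m≤o∸n (suc i) lt

      f-row-above : ∀ i d → suc i + d < n → f (suc i) (suc i + d) ≤ f i (suc i + d)
      f-row-above i d lt = subst₂ _≤_
        (trans (cong (λ k → g k (suc i)) (sym (n∸k≡suc d<n))) (sym (f-above (suc i) d)))
        (trans (sym (f-above i (suc d))) (cong (f i) (+-suc i d)))
        (shrink inter (n∸d>i (subst (_< n) (sym (+-suc i d)) lt)) (subst (_≤ n) (n∸k≡suc d<n) (m∸n≤m n d)))
        where
        d<n : d < n
        d<n = ≤-<-trans (m≤n+m d (suc i)) lt

      f-row-below : ∀ j d → suc (j + d) < n → f (suc (j + d)) j ≤ f (j + d) j
      f-row-below j d lt = subst₂ _≤_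
        (trans (sym (f-below j (suc d))) (cong (λ i → f i j) (+-suc j d)))
        (trans (cong (λ k → g k j) (sym (n∸k≡suc d<n))) (sym (f-below j d)))
        (grow inter (n∸d>i (subst (_< n) (sym (+-suc j d)) lt)) (subst (_≤ n) (n∸k≡suc d<n) (m∸n≤m n d)))
        where
        d<n : d < n
        d<n = ≤-<-trans (m≤n+m d j) (<⇒≤ lt)

      f-row : ∀ {i j} → suc i < n → j < n → f (suc i) j ≤ f i j
      f-row {i} {j} 1+i<n j<n with i <? j
      ... | yes i<j rewrite sym (m+[n∸m]≡n i<j) = f-row-above i (j ∸ suc i) j<n
      ... | no  i≮j rewrite sym (m+[n∸m]≡n (≮⇒≥ i≮j)) = f-row-below j (i ∸ j) 1+i<n

      f-planePartition : PlanePartition n c f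
      f-planePartition = record
        { bounded = λ {i} {j} _ _ → count-≤ bs (n ∸ ∣ i - j ∣) (i ⊓ j)
        ; row = f-row
        ; col = λ {i} {j} i<n 1+j<n → subst₂ _≤_ (f-symmetric (suc j) i) (f-symmetric j i) (f-row 1+j<n i<n)
        }

    levels⇒symmetric : ∃ λ (σ : Array n) → (IsPlanePartition n c σ × IsSymmetric σ) × Levels bs (diagonals σ)
    levels⇒symmetric = array n f
      , (planePartition⁺ f-planePartition
        , λ i j → trans (entry-array n f i j) (trans (f-symmetric (toℕ i) (toℕ j)) (sym (entry-array n f j i))))
      , levels-cong bs diagonal≡ (count-levels desc)
      where
      diagonal≡ : ∀ {k i} → i < k → k ≤ n → g k i ≡ diagonals (array n f) k i
      diagonal≡ {k} {i} i<k k≤n = sym (trans (at-array f (<-≤-trans i<k k≤n) (i+[n∸k]<n i<k k≤n))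
        (trans (f-above i (n ∸ k)) (cong (λ k → g k i) (m∸[m∸n]≡n k≤n))))

  levels-symmetric-injective : ∀ {σ σ′ : Array n} (bs : Vec (Vec Bool n) c) → IsSymmetric σ → IsSymmetric σ′ →
    Levels bs (diagonals σ) → Levels bs (diagonals σ′) → σ ≡ σ′
  levels-symmetric-injective {σ} {σ′} bs sym₁ sym₂ lev lev′ =
    at-injective λ {i} {j} i<n j<n → agree i<n j<n (≤-total i j)
    where
    swap : ∀ (σ : Array n) → IsSymmetric σ → ∀ {i j} → i < n → j < n → at σ i j ≡ at σ j i
    swap σ symm i<n j<n = trans (sym (entry-at σ i<n j<n)) (trans (symm _ _) (entry-at σ j<n i<n))

    upper : ∀ {i j} → i ≤ j → j < n → at σ i j ≡ at σ′ i j
    upper {i} {j} i≤j j<n = subst (λ j → at σ i j ≡ at σ′ i j) col≡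
      (levels-functional bs lev lev′ i<k (m∸n≤m n (j ∸ i)))
      where
      d≤n : j ∸ i ≤ n
      d≤n = ≤-trans (m∸n≤m j i) (<⇒≤ j<n)
      i<k : i < n ∸ (j ∸ i)
      i<k = m+n≤o⇒m≤o∸n (suc i) (subst (_< n) (sym (m+[n∸m]≡n i≤j)) j<n)
      col≡ : i + (n ∸ (n ∸ (j ∸ i))) ≡ j
      col≡ = trans (cong (i +_) (m∸[m∸n]≡n d≤n)) (m+[n∸m]≡n i≤j)

    agree : ∀ {i j} → i < n → j < n → i ≤ j ⊎ j ≤ i → at σ i j ≡ at σ′ i j
    agree i<n j<n (inj₁ i≤j) = upper i≤j j<n
    agree i<n j<n (inj₂ j≤i) = trans (swap σ sym₁ i<n j<n) (trans (upper j≤i i<n) (swap σ′ sym₂ j<n i<n))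

-- Quasi transpose-complementary plane partitions as staircases

mirror : ∀ {n} → Array n → ℕ → ℕ → ℕ
mirror {n} π i j = at π i (n ∸ suc j)

lower : ∀ {n} → Array n → ℕ → ℕ → ℕ
lower π s j = mirror π j s

module _ {n c : ℕ} where

  private
    reflect< : ∀ {j} → j < n → n ∸ suc j < n
    reflect< {j} j<n = ∸-monoʳ-< {n} (s≤s z≤n) j<n

    reflect-involutive : ∀ {j} → j < n → n ∸ suc (n ∸ suc j) ≡ j
    reflect-involutive {j} j<n = trans (cong (n ∸_) (sym (n∸k≡suc j<n))) (m∸[m∸n]≡n (<⇒≤ j<n))

  mirror-col : ∀ (π : Array n) → PlanePartition n c (at π) →
    ∀ {i j} → i < n → suc j < n → mirror π i j ≤ mirror π i (suc j)
  mirror-col π pp {i} {j} i<n 1+j<n rewrite n∸k≡suc 1+j<n =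
    col pp i<n (subst (_< n) (n∸k≡suc 1+j<n) (reflect< (<⇒≤ 1+j<n)))

  mirror-row : ∀ (π : Array n) → PlanePartition n c (at π) →
    ∀ {i j} → suc i < n → j < n → mirror π (suc i) j ≤ mirror π i j
  mirror-row π pp 1+i<n j<n = row pp 1+i<n (reflect< j<n)

  mirror-toℕ : ∀ (π : Array n) i j → mirror π (toℕ i) (toℕ j) ≡ entry π i (opposite j)
  mirror-toℕ π i j = trans (cong (at π (toℕ i)) (sym (opposite-prop j))) (at-toℕ π i (opposite j))

  mirror-complement : ∀ (π : Array n) → IsQuasiTC n c π → ∀ {i j} → i < n → j < n → i ≢ j →
    mirror π i j + mirror π j i ≡ c
  mirror-complement π qtc {i} {j} i<n j<n i≢j =
    subst₂ (λ i j → mirror π i j + mirror π j i ≡ c) (toℕ-fromℕ< i<n) (toℕ-fromℕ< j<n)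
      (trans (cong₂ _+_ (mirror-toℕ π i′ j′) (trans (mirror-toℕ π j′ i′)
          (cong (λ k → entry π k (opposite i′)) (sym (opposite-involutive j′)))))
        (qtc i′ (opposite j′) λ eq → i≢j
          (trans (sym (toℕ-fromℕ< i<n)) (trans (cong toℕ (trans eq (opposite-involutive j′))) (toℕ-fromℕ< j<n)))))
    where
    i′ = fromℕ< i<n
    j′ = fromℕ< j<n

  -- For the diagonal condition, a diagonal entry of the mirrored matrix is at most its neighbours
  -- above and to the right. These lie above the diagonal, hence are `c` minus the reflected
  -- entries, which are the ones in the staircase.
  quasiTC⇒staircase : ∀ (π : Array n) → IsPlanePartition n c π → IsQuasiTC n c π → Staircase n c (lower π)
  quasiTC⇒staircase π isPP qtc = record { up = up′ ; left = left′ ; diagonal = diagonal′ }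
    where
    pp = planePartition⁻ π isPP

    up′ : ∀ {s j} → suc s ≤ j → j < n → lower π s j ≤ lower π (suc s) j
    up′ s<j j<n = mirror-col π pp j<n (≤-<-trans s<j j<n)

    left′ : ∀ {s j} → s ≤ j → j < n → lower π s (suc j) ≤ lower π s j
    left′ {s} {j} s≤j j<n with suc j <? n
    ... | yes 1+j<n = mirror-row π pp 1+j<n (≤-<-trans s≤j j<n)
    -- Here the neighbour lies outside the array, where `at` returns 0.
    ... | no  1+j≮n = ≤-trans (≤-reflexive (at-outside π _ (≮⇒≥ 1+j≮n))) z≤n

    before-bound : ∀ j → j < n → mirror π j j + before 0 (λ s → lower π s j) j ≤ c
    before-bound zero    0<n   = ≤-trans (≤-reflexive (+-identityʳ _)) (bounded pp 0<n (reflect< 0<n))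
    before-bound (suc j) 1+j<n = ≤-trans (+-monoˡ-≤ _ (mirror-row π pp 1+j<n 1+j<n))
      (≤-reflexive (mirror-complement π qtc (<⇒≤ 1+j<n) 1+j<n (λ eq → 1+n≢n (sym eq))))

    after-bound : ∀ {j} → j < n → mirror π j j + lower π j (suc j) ≤ c
    after-bound {j} j<n with suc j <? n
    ... | yes 1+j<n = ≤-trans (+-monoˡ-≤ _ (mirror-col π pp j<n 1+j<n))
      (≤-reflexive (mirror-complement π qtc j<n 1+j<n (λ eq → 1+n≢n (sym eq))))
    ... | no  1+j≮n = ≤-trans (≤-reflexive (trans (cong (mirror π j j +_) (at-outside π _ (≮⇒≥ 1+j≮n))) (+-identityʳ _)))
      (bounded pp j<n (reflect< j<n))

    diagonal′ : ∀ {j} → j < n → lower π j j + (before 0 (λ s → lower π s j) j ⊔ lower π j (suc j)) ≤ c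
    diagonal′ {j} j<n = to (⊔-bound (lower π j j) _ _) (before-bound j j<n , after-bound j<n)

  module _ (f : ℕ → ℕ → ℕ) (st : Staircase n c f) where

    private
      -- The diagonal goes with the part copied from `f`, since complementation leaves it free; the
      -- condition `diagonal` is what makes rows and columns monotone when they cross it.
      e : ℕ → ℕ → ℕ
      e i j with j ≤? i
      ... | yes _ = f j i
      ... | no  _ = c ∸ f i j

      e-lower : ∀ {i j} → j ≤ i → e i j ≡ f j i
      e-lower {i} {j} j≤i with j ≤? i
      ... | yes _   = refl
      ... | no  j≰i = contradiction j≤i j≰i

      e-upper : ∀ {i j} → i < j → e i j ≡ c ∸ f i j
      e-upper {i} {j} i<j with j ≤? i
      ... | yes j≤i = contradiction i<j (≤⇒≯ j≤i)
      ... | no  _   = refl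

      diagonal-before : ∀ {j} → suc j < n → f (suc j) (suc j) ≤ c ∸ f j (suc j)
      diagonal-before {j} 1+j<n = m+n≤o⇒m≤o∸n _
        (proj₁ (from (⊔-bound (f (suc j) (suc j)) (f j (suc j)) _) (diagonal st 1+j<n)))

      diagonal-after : ∀ {j} → j < n → f j j ≤ c ∸ f j (suc j)
      diagonal-after {j} j<n = m+n≤o⇒m≤o∸n _
        (proj₂ (from (⊔-bound (f j j) (before 0 (λ s → f s j) j) _) (diagonal st j<n)))

      e-row : ∀ {i j} → suc i < n → j < n → e (suc i) j ≤ e i j
      e-row {i} {j} 1+i<n j<n with <-cmp j (suc i)
      ... | tri< (s≤s j≤i) _ _ = subst₂ _≤_ (sym (e-lower (m≤n⇒m≤1+n j≤i))) (sym (e-lower j≤i)) (left st j≤i (<⇒≤ 1+i<n))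
      ... | tri≈ _ refl _ = subst₂ _≤_ (sym (e-lower ≤-refl)) (sym (e-upper ≤-refl)) (diagonal-before 1+i<n)
      ... | tri> _ _ 1+i<j = subst₂ _≤_ (sym (e-upper 1+i<j)) (sym (e-upper (<⇒≤ 1+i<j)))
        (∸-monoʳ-≤ c (up st (<⇒≤ 1+i<j) j<n))

      e-col : ∀ {i j} → i < n → suc j < n → e i j ≤ e i (suc j)
      e-col {i} {j} i<n 1+j<n with <-cmp j i
      ... | tri< j<i _ _ = subst₂ _≤_ (sym (e-lower (<⇒≤ j<i))) (sym (e-lower j<i)) (up st j<i i<n)
      ... | tri≈ _ refl _ = subst₂ _≤_ (sym (e-lower ≤-refl)) (sym (e-upper ≤-refl)) (diagonal-after i<n)
      ... | tri> _ _ i<j = subst₂ _≤_ (sym (e-upper i<j)) (sym (e-upper (m≤n⇒m≤1+n i<j)))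
        (∸-monoʳ-≤ c (left st (<⇒≤ i<j) (<⇒≤ 1+j<n)))

      -- Values rise down a column to the diagonal, where they are bounded. This makes the truncated
      -- subtraction in `e` exact.
      f≤c : ∀ {s j} → s ≤ j → j < n → f s j ≤ c
      f≤c {s} {j} s≤j j<n = climb (j ∸ s) (m+[n∸m]≡n s≤j)
        where
        climb : ∀ d {s} → s + d ≡ j → f s j ≤ c
        climb zero    {s} eq rewrite trans (sym (+-identityʳ s)) eq =
          ≤-trans (diagonal-after j<n) (m∸n≤m c (f j (suc j)))
        climb (suc d) {s} eq = ≤-trans (up st s<j j<n) (climb d (trans (sym (+-suc s d)) eq))
          where
          s<j : s < j
          s<j = ≤-trans (s≤s (m≤m+n s d)) (≤-reflexive (trans (sym (+-suc s d)) eq))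

      e-bounded : ∀ {i j} → i < n → j < n → e i j ≤ c
      e-bounded {i} {j} i<n j<n with j ≤? i
      ... | yes j≤i = f≤c j≤i i<n
      ... | no  _   = m∸n≤m c (f i j)

      e-complement : ∀ {i j} → i < n → j < n → i ≢ j → e i j + e j i ≡ c
      e-complement {i} {j} i<n j<n i≢j with <-cmp i j
      ... | tri< i<j _ _ = trans (cong₂ _+_ (e-upper i<j) (e-lower (<⇒≤ i<j))) (m∸n+n≡m (f≤c (<⇒≤ i<j) j<n))
      ... | tri≈ _ i≡j _ = contradiction i≡j i≢j
      ... | tri> _ _ j<i = trans (cong₂ _+_ (e-lower (<⇒≤ j<i)) (e-upper j<i)) (m+[n∸m]≡n (f≤c (<⇒≤ j<i) i<n))

      p : ℕ → ℕ → ℕ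
      p i k = e i (n ∸ suc k)

      p-planePartition : PlanePartition n c p
      p-planePartition = record
        { bounded = λ i<n k<n → e-bounded i<n (reflect< k<n)
        ; row     = λ 1+i<n k<n → e-row 1+i<n (reflect< k<n)
        ; col     = λ {i} {k} i<n 1+k<n → subst (λ j → p i (suc k) ≤ e i j) (sym (n∸k≡suc 1+k<n))
            (e-col i<n (subst (_< n) (n∸k≡suc 1+k<n) (reflect< (<⇒≤ 1+k<n))))
        }

    staircase⇒quasiTC : ∃ λ (π : Array n) →
      (IsPlanePartition n c π × IsQuasiTC n c π) × triangle n (lower π) ≡ triangle n f
    staircase⇒quasiTC = array n p , (planePartition⁺ p-planePartition , complement) , triangle-cong n lower≡
      where
      complement : IsQuasiTC n c (array n p)
      complement i j i≢j′ = trans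
        (cong₂ _+_
          (trans (entry-array n p i j) (cong (e (toℕ i)) (sym (opposite-prop j))))
          (trans (entry-array n p (opposite j) (opposite i))
            (cong (e (toℕ (opposite j))) (trans (sym (opposite-prop (opposite i))) (cong toℕ (opposite-involutive i))))))
        (e-complement (toℕ<n i) (toℕ<n (opposite j)) (i≢j′ ∘ toℕ-injective))

      lower≡ : ∀ {s j} → s ≤ j → j < n → lower (array n p) s j ≡ f s j
      lower≡ {s} {j} s≤j j<n = trans (at-array p j<n (reflect< s<n))
        (trans (cong (e j) (reflect-involutive s<n)) (e-lower s≤j))
        where s<n = ≤-<-trans s≤j j<n

  quasiTC-injective : ∀ {π π′ : Array n} → IsQuasiTC n c π → IsQuasiTC n c π′ →
    triangle n (lower π) ≡ triangle n (lower π′) → π ≡ π′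
  quasiTC-injective {π} {π′} qtc qtc′ eq = at-injective λ {i} {k} i<n k<n →
    subst (λ k → at π i k ≡ at π′ i k) (reflect-involutive k<n) (agree i<n (reflect< k<n))
    where
    agree-lower : ∀ {i j} → j ≤ i → i < n → mirror π i j ≡ mirror π′ i j
    agree-lower = triangle-injective n eq

    agree : ∀ {i j} → i < n → j < n → mirror π i j ≡ mirror π′ i j
    agree {i} {j} i<n j<n with j ≤? i
    ... | yes j≤i = agree-lower j≤i i<n
    ... | no  j≰i = +-cancelʳ-≡ (mirror π j i) _ _ (begin
      mirror π i j + mirror π j i    ≡⟨ mirror-complement π qtc i<n j<n i≢j ⟩
      c                              ≡⟨ mirror-complement π′ qtc′ i<n j<n i≢j ⟨
      mirror π′ i j + mirror π′ j i  ≡⟨ cong (mirror π′ i j +_) (agree-lower (<⇒≤ (≰⇒> j≰i)) j<n) ⟨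
      mirror π′ i j + mirror π j i   ∎)
      where
      open ≡-Reasoning
      i≢j : i ≢ j
      i≢j refl = j≰i ≤-refl

-- The correspondence and the equality of the counts

Corresponds : ∀ {n} c → Array n → Array n → Set
Corresponds {n} c π σ = ∃ λ T → ∃ λ (bs : Vec (Vec Bool n) c) →
  Weights n (lower π) T × Peels T bs × Levels bs (diagonals σ)

module _ {n c : ℕ} where

  QuasiTC Symmetric : Array n → Set
  QuasiTC π   = IsPlanePartition n c π × IsQuasiTC n c π
  Symmetric σ = IsPlanePartition n c σ × IsSymmetric σ

  corresponding-symmetric : ∀ π → QuasiTC π → ∃ λ σ → Symmetric σ × Corresponds c π σ
  corresponding-symmetric π (pp , qtc) =
    let (T , le , wt)     = weights (λ _ → at-outside π _ ≤-refl) (quasiTC⇒staircase π pp qtc)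
        (bs , desc , ps)  = peels c T le
        (σ , symm , lev)  = levels⇒symmetric bs desc
    in σ , symm , T , bs , wt , ps , lev

  corresponding-quasiTC : ∀ σ → Symmetric σ → ∃ λ π → QuasiTC π × Corresponds c π σ
  corresponding-quasiTC σ (pp , _) =
    let (bs , desc , lev) = symmetric⇒levels σ pp
        (T , le , ps)     = unpeels desc
        (f , st , wt)     = unweights T le
        (π , q , eq)      = staircase⇒quasiTC f st
    in π , q , T , bs , trans eq wt , ps , lev

  corresponds-injective : ∀ {π π′} σ → QuasiTC π → QuasiTC π′ →
    Corresponds c π σ → Corresponds c π′ σ → π ≡ π′
  corresponds-injective σ (_ , qtc) (_ , qtc′) (_ , bs , wt , ps , lev) (_ , bs′ , wt′ , ps′ , lev′)
    with refl ← levels-injective bs bs′ lev lev′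
    with refl ← peels-injective ps ps′ = quasiTC-injective qtc qtc′ (trans wt (sym wt′))

  corresponds-functional : ∀ {σ σ′} π → Symmetric σ → Symmetric σ′ →
    Corresponds c π σ → Corresponds c π σ′ → σ ≡ σ′
  corresponds-functional π (_ , symm) (_ , symm′) (_ , bs , wt , ps , lev) (_ , bs′ , wt′ , ps′ , lev′)
    with refl ← weights-functional {f = lower π} wt wt′
    with refl ← peels-functional ps ps′ = levels-symmetric-injective bs symm symm′ lev lev′

quasiTC≡symmetric : ∀ n c → numQuasiTCPP n c ≡ numSymmetricPP n c
quasiTC≡symmetric n c = ≤-antisym
  (length-filter-≤ quasiTC? symmetric? (Corresponds c) (allArrays-unique n c)
    (λ (pp , _) → ∈-allArrays (proj₁ pp)) corresponding-symmetric corresponds-injective)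
  (length-filter-≤ symmetric? quasiTC? (λ σ π → Corresponds c π σ) (allArrays-unique n c)
    (λ (pp , _) → ∈-allArrays (proj₁ pp)) corresponding-quasiTC corresponds-functional)
  where
  quasiTC? : Decidable QuasiTC
  quasiTC? π = isPP? n c π ×-dec isQTC? n c π
  symmetric? : Decidable Symmetric
  symmetric? σ = isPP? n c σ ×-dec isSym? σ

theorem1p2 : (n c : ℕ) → numQuasiTCPP (suc n) (suc c) ≡ numSymmetricPP (suc n) (suc c)
theorem1p2 n c = quasiTC≡symmetric (suc n) (suc c)
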